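{- There is a function $f:\mathbb{N}\to\mathbb{N}$ such that for every tournament $T$, we have $\overrightarrow{\omega}(T) < f(\omega_A(T)+\omega_D(T))$.
   Context: A tournament is a finite directed graph with exactly one arc between each pair of distinct vertices. For a total ordering $<$ of $V(T)$, the backedge graph $B(T,<)$ is the graph on $V(T)$ with an edge $uv$ for every pair $u<v$ with $vu \in A(T)$. The clique number of a tournament is $\overrightarrow{\omega}(T)=\min_{<}\omega(B(T,<))$ over all total orderings of $V(T)$. A tournament contains (a copy of) $H$ if some induced subtournament is isomorphic to $H$. For disjoint vertex sets $X,Y$, $X \Rightarrow Y$ means $xy\in A(T)$ for all $x\in X$, $y \in Y$. The tournament $A_1$ is a single vertex; for $n\ge 2$, $A_n$ consists of vertex-disjoint tournaments $T_1,\dots,T_{n-1}$, each isomorphic to $A_{n-1}$, and further vertices $v_1,\dots,v_n$, with: $A_n[V(T_i)]=T_i$; $v_j\Rightarrow v_i$ whenever $i<j$; $V(T_i)\Rightarrow V(T_j)$ whenever $i<j$; $v_i\Rightarrow V(T_j)$ whenever $i\le j$; and $V(T_j)\Rightarrow v_i$ whenever $i>j$. The tournament $D_1$ is a single vertex, and $D_n$ is obtained from two disjoint copies $T_1,T_2$ of $D_{n-1}$ and one further vertex $w$ with $V(T_1)\Rightarrow V(T_2)$, $V(T_2)\Rightarrow w$, $w \Rightarrow V(T_1)$. $\omega_A(T)$ is the maximum $n$ such that $T$ contains a copy of $A_n$, and $\omega_D(T)$ is the maximum $n$ such that $T$ contains a copy of $D_n$. -}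

module Defs where

open import Data.Nat using (ℕ; zero; suc; _+_; _≤_; _<_; _<ᵇ_; _≤ᵇ_; _≡ᵇ_)
open import Data.Bool using (Bool; true; false; not; if_then_else_)
open import Data.Fin using (Fin; toℕ)
open import Data.Fin.Subset using (Subset; _∈_; ∣_∣)
open import Data.Product using (Σ; _×_; _,_; ∃)
open import Data.Sum using (_⊎_)
open import Data.Empty using (⊥)
open import Relation.Binary.PropositionalEquality using (_≡_; _≢_)
open import Function.Definitions using (Injective)

record Tournament : Set where
  field
    size   : ℕ
    arc    : Fin size → Fin size → Bool
    irrefl : ∀ u → arc u u ≡ false
    oneArc : ∀ u v → u ≢ v → arc u v ≡ not (arc v u)
open Tournament public

Contains : (T : Tournament) (V : Set) (harc : V → V → Bool) → Set
Contains T V harc =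
  Σ (V → Fin (size T)) λ φ →
    Injective _≡_ _≡_ φ × (∀ u v → arc T (φ u) (φ v) ≡ harc u v)

-- D_{k+1} has vertex type DV k.
-- D_1 = single vertex; D_{k+2} = two copies T1 (left), T2 (right) of
-- D_{k+1} plus w, with T1 ⇒ T2, T2 ⇒ w, w ⇒ T1.

data DV : ℕ → Set where
  d-one   : DV zero
  d-left  : ∀ {k} → DV k → DV (suc k)
  d-right : ∀ {k} → DV k → DV (suc k)
  d-w     : ∀ {k} → DV (suc k)

darc : ∀ {k} → DV k → DV k → Bool
darc d-one d-one = false
darc (d-left x)  (d-left y)  = darc x y
darc (d-right x) (d-right y) = darc x y
darc (d-left x)  (d-right y) = true
darc (d-right x) (d-left y)  = false
darc (d-right x) d-w         = true
darc d-w         (d-right y) = false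
darc d-w         (d-left y)  = true
darc (d-left x)  d-w         = false
darc d-w         d-w         = false

-- A_{k+1} has vertex type AV k.
-- A_1 = single vertex; A_{k+2} = copies T_0,…,T_k of A_{k+1} (a-t i x)
-- and vertices v_0,…,v_{k+1} (a-v i)  (0-based indices, i.e. the paper's
-- T_{i+1}, v_{i+1}), with
--   T_i ⇒ T_j  (i < j),  v_j ⇒ v_i (i < j),
--   v_i ⇒ T_j  (i ≤ j),  T_j ⇒ v_i (i > j).

data AV : ℕ → Set where
  a-one : AV zero
  a-t   : ∀ {k} → Fin (suc k) → AV k → AV (suc k)
  a-v   : ∀ {k} → Fin (suc (suc k)) → AV (suc k)

aarc : ∀ {k} → AV k → AV k → Bool
aarc a-one a-one = false
aarc (a-t i x) (a-t j y) =
  if toℕ i ≡ᵇ toℕ j then aarc x y else (toℕ i <ᵇ toℕ j)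
aarc (a-v i) (a-v j) = toℕ j <ᵇ toℕ i
aarc (a-v i) (a-t j y) = toℕ i ≤ᵇ toℕ j
aarc (a-t j y) (a-v i) = toℕ j <ᵇ toℕ i

HasA : Tournament → ℕ → Set
HasA T zero    = ⊥
HasA T (suc k) = Contains T (AV k) aarc

HasD : Tournament → ℕ → Set
HasD T zero    = ⊥
HasD T (suc k) = Contains T (DV k) darc

-- ω_A(T) = a : a is the maximum n with a copy of A_n (0 if there is none,
-- which only happens for the empty tournament).
IsOmegaA : Tournament → ℕ → Set
IsOmegaA T a = (a ≡ 0 ⊎ HasA T a) × (∀ n → HasA T n → n ≤ a)

IsOmegaD : Tournament → ℕ → Set
IsOmegaD T d = (d ≡ 0 ⊎ HasD T d) × (∀ n → HasD T n → n ≤ d)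

-- Total orderings of V(T): u < v iff pos u < pos v for an injective
-- (hence bijective) pos : Fin size → Fin size.

Ordering : Tournament → Set
Ordering T = Σ (Fin (size T) → Fin (size T)) λ pos → Injective _≡_ _≡_ pos

BackEdge : (T : Tournament) → Ordering T → Fin (size T) → Fin (size T) → Set
BackEdge T (pos , _) u v =
    (toℕ (pos u) < toℕ (pos v) × arc T v u ≡ true)
  ⊎ (toℕ (pos v) < toℕ (pos u) × arc T u v ≡ true)

IsClique : (T : Tournament) → Ordering T → Subset (size T) → Set
IsClique T o S = ∀ u v → u ∈ S → v ∈ S → u ≢ v → BackEdge T o u v

IsCliqueNumber : (T : Tournament) → Ordering T → ℕ → Set
IsCliqueNumber T o k =
  (Σ (Subset (size T)) λ S → IsClique T o S × ∣ S ∣ ≡ k)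
  × (∀ S → IsClique T o S → ∣ S ∣ ≤ k)

IsDiCliqueNumber : Tournament → ℕ → Set
IsDiCliqueNumber T k =
  (Σ (Ordering T) λ o → IsCliqueNumber T o k)
  × (∀ o k' → IsCliqueNumber T o k' → k ≤ k')

{-# OPTIONS --safe #-}
-- Let w be the clique number of the subtournament on a vertex set; it is monotone and subadditive,
-- and every set X is dominated by at most w X of its vertices.  By induction, in a tournament T
-- without A_{k+1} and D_{n+1} every set of weight more than c contains both A_k and D_n.
--
-- For a copy A of D_n, let C⁻(A) and C⁺(A) be its common in- and out-neighbourhood.  Since there
-- is no D_{n+1}, every vertex on either side has only a c-light set of wrong arcs to the other
-- side: C⁻(A) ≪ C⁺(A).
--
-- (1) If, at every scale, each set P is split into two heavy parts by all vertices outside a light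
--     set, then D_{n+1} embeds greedily.  So some heavy Y, Z satisfy: all vertices of Z have a
--     light out-neighbourhood in Y (or the same for in-neighbourhoods).
-- (2) Every heavy X contains a copy A of D_n with C⁺(A) ∩ X heavy.  Otherwise iterating (1) gives
--     heavy U and V₁, …, Vₖ with light out-neighbourhoods between any two of them, except from Vⱼ
--     into Vᵢ for i < j.  Choose blocks A_k in V₁, V₂, … one after the other, each dominating what
--     has been chosen, and between two choices dominate the rest of U by boundedly many vertices;
--     this produces A_{k+1}.
-- (3) By (1), (2) and the reverse of (2), every heavy set contains a copy A of D_n with both C⁻(A)
--     and C⁺(A) heavy, hence four heavy sets Y₁ ≪ Y₂ ≪ Y₃ ≪ Y₄.
-- (4) In a longest sequence X₁ ≪ X₂ ≪ … of heavy sets each vertex v has a position: X₁, …, Xᵢ₋₁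
--     point mostly to v and v points mostly to Xᵢ₊₁, ….  A heavy set of vertices of the same
--     position would allow replacing Xᵢ₋₁, Xᵢ, Xᵢ₊₁ by four sets.  Ordered by position, a backward
--     clique meets fewer than 2k + 1 positions, since otherwise blocks A_k found in the Xᵢ between
--     every other of its vertices give A_{k+1}.
module Submission where

open import Defs
open import Data.Nat using (ℕ; _+_; _<_)
open import Data.Product using (Σ)

open import Data.Bool using (Bool; true; false; not; _∧_) renaming (_≟_ to _≟ᵇ_)
open import Data.Bool.ListAction using (all)
open import Data.Bool.Properties using (T-≡)
open import Data.Empty using (⊥; ⊥-elim)
open import Data.Fin using (Fin; toℕ; zero; suc; inject≤)
open import Data.Fin.Properties using (injective⇒≤; toℕ-injective; toℕ<n; toℕ-inject≤; inject≤-injective) renaming (_≟_ to _≟ᶠ_)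
open import Data.Fin.Subset using (Subset; ∣_∣) renaming (_∈_ to _∈ₛ_; ⊥ to ∅)
open import Data.Fin.Subset.Properties using (∣⊥∣≡0; ∉⊥) renaming (_∈?_ to _∈ₛ?_)
open import Data.List using (List; []; _∷_; _++_; length; map; concatMap; take; drop; filter; reverse; lookup; allFin)
open import Data.List.Membership.DecPropositional using () renaming (_∈?_ to ∈-dec)
open import Data.List.Membership.Propositional using () renaming (_∈_ to _∈ₗ_)
open import Data.List.Membership.Propositional.Properties using (∈-filter⁺; ∈-filter⁻; ∈-++⁺ˡ; ∈-++⁺ʳ; ∈-lookup; ∈-allFin)
open import Data.List.Properties using (length-map; length-++; length-take; length-drop; length-filter; length-reverse; unfold-reverse; reverse-involutive; tabulate-lookup)
open import Data.List.Relation.Binary.Sublist.Propositional using (_⊆_; []; _∷_; _∷ʳ_; ⊆-trans)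
open import Data.List.Relation.Binary.Sublist.Propositional.Properties using (filter-⊆; reverse⁺; length-mono-≤; All-resp-⊆)
open import Data.List.Relation.Unary.All as All using (All; []; _∷_)
import Data.List.Relation.Unary.All.Properties as Allₚ
open import Data.List.Relation.Unary.AllPairs as AllPairs using (AllPairs; []; _∷_)
import Data.List.Relation.Unary.AllPairs.Properties as AllPairsₚ
open import Data.List.Relation.Unary.Any as Any using (Any; here; there; index)
import Data.List.Relation.Unary.Any.Properties as Anyₚ
open import Data.Nat using (zero; suc; _*_; _∸_; _≤_; _≤ᵇ_; _<ᵇ_; _≡ᵇ_; z≤n; s≤s; s≤s⁻¹)
open import Data.Nat.Properties
open import Data.Product using (∃; _×_; _,_; proj₁; proj₂)
open import Data.Sum using (_⊎_; inj₁; inj₂)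
open import Data.Vec as Vec using (Vec; []; _∷_)
open import Data.Vec.Properties using (lookup∘tabulate)
open import Function using (flip; _∘_; id)
open import Function.Bundles using (Equivalence)
open import Function.Definitions using (Injective)
open import Relation.Binary.Definitions using (tri<; tri≈; tri>)
open import Relation.Binary.PropositionalEquality using (_≡_; _≢_; refl; sym; trans; cong; cong₂; subst)
open import Relation.Nullary using (¬_; yes; no)
open import Relation.Nullary.Decidable using (decidable-stable)

-- Booleans and arithmetic

∧-intro : ∀ {a b} → a ≡ true → b ≡ true → a ∧ b ≡ true
∧-intro refl refl = refl

∧-left : ∀ {a b} → a ∧ b ≡ true → a ≡ true
∧-left {true} _ = refl

∧-right : ∀ {a b} → a ∧ b ≡ true → b ≡ true
∧-right {true} eq = eq

not-false : ∀ {b} → not b ≡ true → ¬ (b ≡ true)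
not-false {false} _ ()

dichotomy : ∀ b → b ≡ true ⊎ not b ≡ true
dichotomy true  = inj₁ refl
dichotomy false = inj₂ refl

all-intro : ∀ {A : Set} {p : A → Bool} {xs} → All (λ x → p x ≡ true) xs → all p xs ≡ true
all-intro []         = refl
all-intro (px ∷ pxs) = ∧-intro px (all-intro pxs)

all-elim : ∀ {A : Set} {p : A → Bool} xs → all p xs ≡ true → All (λ x → p x ≡ true) xs
all-elim []       _  = []
all-elim (x ∷ xs) eq = ∧-left eq ∷ all-elim xs (∧-right eq)

≤ᵇ-intro : ∀ {m n} → m ≤ n → (m ≤ᵇ n) ≡ true
≤ᵇ-intro m≤n = Equivalence.to T-≡ (≤⇒≤ᵇ m≤n)

≤ᵇ-elim : ∀ {m n} → (m ≤ᵇ n) ≡ true → m ≤ n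
≤ᵇ-elim eq = ≤ᵇ⇒≤ _ _ (Equivalence.from T-≡ eq)

<ᵇ-intro : ∀ {m n} → m < n → (m <ᵇ n) ≡ true
<ᵇ-intro m<n = Equivalence.to T-≡ (<⇒<ᵇ m<n)

<ᵇ-elim : ∀ {m n} → (m <ᵇ n) ≡ true → m < n
<ᵇ-elim eq = <ᵇ⇒< _ _ (Equivalence.from T-≡ eq)

-- For the ubiquitous cutting step: a set of weight above `K` that loses at most `e` keeps weight
-- above `d`.
remains : ∀ {x y e d K} → x ≤ y + e → d + e ≤ K → K < x → d < y
remains {y = y} {e} {d} x≤ d≤ K<x = +-cancelʳ-< e d y (≤-<-trans d≤ (<-≤-trans K<x x≤))

-- The tournaments as patterns of vertices and blocks

data Item (V : Set) : Set where
  vtx : V → Item V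
  blk : List V → Item V

verts : ∀ {V} → Item V → List V
verts (vtx v) = v ∷ []
verts (blk Z) = Z

flat : ∀ {V} → List (Item V) → List V
flat = concatMap verts

-- The shape T₁ v₂ T₂ v₃ … Tₘ vₘ₊₁ with blocks satisfying P.
data Alternating {V : Set} (P : List V → Set) : ℕ → List (Item V) → Set where
  []   : Alternating P 0 []
  cons : ∀ {m Z v is} → P Z → Alternating P m is → Alternating P (suc m) (blk Z ∷ vtx v ∷ is)

module Pattern {V : Set} (arc : V → V → Bool) where

  infix 4 _⟶_ _⇒_ _◁_

  _⟶_ : V → V → Set
  u ⟶ v = arc u v ≡ true

  _⇒_ : List V → List V → Set
  A ⇒ B = All (λ a → All (a ⟶_) B) A

  -- Index j stands for D_{j+1}, and below for A_{j+1}.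
  data IsD : ℕ → List V → Set where
    point : ∀ v → IsD 0 (v ∷ [])
    node  : ∀ {j A B} v → IsD j A → IsD j B →
            All (v ⟶_) A → A ⇒ B → All (_⟶ v) B → IsD (suc j) (v ∷ A ++ B)

  before : V → Item V → Bool
  before u (vtx v) = arc v u
  before u (blk Z) = all (arc u) Z

  -- i ◁ j is the relation required of an item i standing to the left of j in the sequence
  -- v₁ T₁ v₂ T₂ … vₙ: forward arcs throughout, except that two of the vᵢ form a backward arc.
  _◁_ : Item V → Item V → Set
  vtx u ◁ j = before u j ≡ true
  blk Z ◁ j = Z ⇒ verts j

  IsA : ℕ → List V → Set
  IsA zero    l = ∃ λ v → l ≡ v ∷ []
  IsA (suc j) l = ∃ λ u → ∃ λ is → Alternating (IsA j) (suc j) is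
                × AllPairs _◁_ (vtx u ∷ is) × l ≡ flat (vtx u ∷ is)

-- Vertex sets and weights

abstract
  infixl 6 _∩_

  -- Opaque, so that nested intersections stay visible to unification instead of unfolding to
  -- conjunctions.
  _∩_ : ∀ {V : Set} → (V → Bool) → (V → Bool) → V → Bool
  (X ∩ f) v = X v ∧ f v

  ∩-intro : ∀ {V : Set} {X f : V → Bool} {v} → X v ≡ true → f v ≡ true → (X ∩ f) v ≡ true
  ∩-intro = ∧-intro

  ∩-left : ∀ {V : Set} {X f : V → Bool} {v} → (X ∩ f) v ≡ true → X v ≡ true
  ∩-left = ∧-left

  ∩-right : ∀ {V : Set} {X f : V → Bool} {v} → (X ∩ f) v ≡ true → f v ≡ true
  ∩-right {X = X} {v = v} = ∧-right {X v}

module Sets {V : Set} (U : V → Bool) where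

  infix 4 _∈_ _⊑_

  -- Vertex sets are read inside the universe U, so that subtournaments need no separate vertex type.
  record _∈_ (v : V) (S : V → Bool) : Set where
    constructor mem
    field
      univ : U v ≡ true
      isin : S v ≡ true
  open _∈_ public

  _⊑_ : (V → Bool) → (V → Bool) → Set
  X ⊑ Y = ∀ {v} → v ∈ X → v ∈ Y

-- All that the argument uses of the clique number, apart from the bound for layered orderings.
-- `inhab` yields a vertex in continuation form only, since all reasoning here ends in a
-- contradiction.
record Weight {V : Set} (arc : V → V → Bool) (U : V → Bool) : Set where
  open Sets U
  field
    w     : (V → Bool) → ℕ
    mono  : ∀ {X Y} → X ⊑ Y → w X ≤ w Y
    sub   : ∀ {X Y Z} → (∀ {v} → v ∈ X → v ∈ Y ⊎ v ∈ Z) → w X ≤ w Y + w Z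
    sing  : ∀ {X} x → (∀ {v} → v ∈ X → v ≡ x) → w X ≤ 1
    inhab : ∀ {X} → 0 < w X → (∀ {v} → v ∈ X → ⊥) → ⊥
    dom   : ∀ X → ∃ λ Y → All (_∈ X) Y × length Y ≤ w X
                × (∀ {u} → u ∈ X → Any (λ y → y ≡ u ⊎ arc y u ≡ true) Y)
    trim  : ∀ {M X} → M < w X → ∃ λ Y → Y ⊑ X × M < w Y × w Y ≤ suc M

module Calculus {V : Set} (arc : V → V → Bool) (U : V → Bool)
  (tri : ∀ u v → u ≡ v ⊎ arc u v ≡ true ⊎ arc v u ≡ true) (W : Weight arc U) where

  open Sets U public
  open Weight W public
  open Pattern arc public

  infixl 6 _∩⁺_ _∩⁻_ _⊓⁺_ _⊓⁻_

  _∩⁺_ _∩⁻_ : (V → Bool) → V → (V → Bool)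
  X ∩⁺ v = X ∩ (λ u → arc v u)
  X ∩⁻ v = X ∩ (λ u → arc u v)

  _⊓⁺_ _⊓⁻_ : (V → Bool) → List V → (V → Bool)
  X ⊓⁺ l = X ∩ (λ u → all (λ z → arc z u) l)
  X ⊓⁻ l = X ∩ (λ u → all (λ z → arc u z) l)

  ∈-∩ˡ : ∀ {X f : V → Bool} {v} → v ∈ X ∩ f → v ∈ X
  ∈-∩ˡ (mem p q) = mem p (∩-left q)

  ∈-∩ʳ : ∀ {X f : V → Bool} {v} → v ∈ X ∩ f → f v ≡ true
  ∈-∩ʳ (mem p q) = ∩-right q

  ∈-∩ : ∀ {X f : V → Bool} {v} → v ∈ X → f v ≡ true → v ∈ X ∩ f
  ∈-∩ (mem p q) r = mem p (∩-intro q r)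

  ∩-mono : ∀ {X Y f : V → Bool} → X ⊑ Y → X ∩ f ⊑ Y ∩ f
  ∩-mono X⊑Y v∈ = ∈-∩ (X⊑Y (∈-∩ˡ v∈)) (∈-∩ʳ v∈)

  w-∩-mono : ∀ {X Y f : V → Bool} → X ⊑ Y → w (X ∩ f) ≤ w (Y ∩ f)
  w-∩-mono X⊑Y = mono (∩-mono X⊑Y)

  w-∩ : ∀ {X f : V → Bool} → w (X ∩ f) ≤ w X
  w-∩ = mono ∈-∩ˡ

  -- Union bound: by subadditivity each test in `as` costs at most `e`, for the vertices that fail
  -- it.
  sieve : ∀ {A : Set} (g : V → A → Bool) {e} R as →
          All (λ a → w (R ∩ (λ v → not (g v a))) ≤ e) as →
          w R ≤ w (R ∩ (λ v → all (g v) as)) + length as * e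
  sieve g R [] [] = ≤-trans (mono (λ v∈ → ∈-∩ v∈ refl)) (m≤m+n _ _)
  sieve g {e} R (a ∷ as) (h ∷ hs) = begin
    w R                                       ≤⟨ sieve g R as hs ⟩
    w R₁ + length as * e                      ≤⟨ +-monoˡ-≤ (length as * e) (sub split) ⟩
    w R₂ + w (R ∩ (λ v → not (g v a))) + length as * e
                                              ≤⟨ +-monoˡ-≤ (length as * e) (+-monoʳ-≤ (w R₂) h) ⟩
    w R₂ + e + length as * e                  ≡⟨ +-assoc (w R₂) e _ ⟩
    w R₂ + (e + length as * e)                ∎
    where
    open ≤-Reasoning
    R₁ R₂ : V → Bool
    R₁ = R ∩ (λ v → all (g v) as)
    R₂ = R ∩ (λ v → all (g v) (a ∷ as))
    split : ∀ {v} → v ∈ R₁ → v ∈ R₂ ⊎ v ∈ R ∩ (λ v → not (g v a))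
    split {v} v∈ with dichotomy (g v a)
    ... | inj₁ yea = inj₁ (∈-∩ (∈-∩ˡ v∈) (∧-intro yea (∈-∩ʳ v∈)))
    ... | inj₂ nay = inj₂ (∈-∩ (∈-∩ˡ v∈) nay)

  unrelated : V → V → Bool
  unrelated z v = not (arc z v) ∧ not (arc v z)

  w-unrelated : ∀ z → w (unrelated z) ≤ 1
  w-unrelated z = sing z only
    where
    only : ∀ {v} → v ∈ unrelated z → v ≡ z
    only {v} v∈ with tri v z
    ... | inj₁ eq        = eq
    ... | inj₂ (inj₁ vz) = ⊥-elim (not-false (∧-right {not (arc z v)} (isin v∈)) vz)
    ... | inj₂ (inj₂ zv) = ⊥-elim (not-false (∧-left (isin v∈)) zv)

  -- A vertex that `z` does not point to is an in-neighbour of `z` or `z` itself; the latter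
  -- accounts for the extra 1.
  miss⁺ : ∀ X z → w (X ∩ (λ v → not (arc z v))) ≤ suc (w (X ∩⁻ z))
  miss⁺ X z = ≤-trans (sub split) (+-monoˡ-≤ _ (w-unrelated z))
    where
    split : ∀ {v} → v ∈ X ∩ (λ v → not (arc z v)) → v ∈ unrelated z ⊎ v ∈ X ∩⁻ z
    split {v} v∈ with dichotomy (arc v z)
    ... | inj₁ vz = inj₂ (∈-∩ (∈-∩ˡ v∈) vz)
    ... | inj₂ nz = inj₁ (mem (univ v∈) (∧-intro (∈-∩ʳ v∈) nz))

  miss⁻ : ∀ X z → w (X ∩ (λ v → not (arc v z))) ≤ suc (w (X ∩⁺ z))
  miss⁻ X z = ≤-trans (sub split) (+-monoˡ-≤ _ (w-unrelated z))
    where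
    split : ∀ {v} → v ∈ X ∩ (λ v → not (arc v z)) → v ∈ unrelated z ⊎ v ∈ X ∩⁺ z
    split {v} v∈ with dichotomy (arc z v)
    ... | inj₁ zv = inj₂ (∈-∩ (∈-∩ˡ v∈) zv)
    ... | inj₂ nz = inj₁ (mem (univ v∈) (∧-intro nz (∈-∩ʳ v∈)))

  -- Turns light wrong neighbourhoods into complete adjacency: for each of at most `s` vertices,
  -- discard its wrong neighbours and the vertex itself.
  cut⁺ : ∀ {X l s τ} → length l ≤ s → All (λ z → w (X ∩⁻ z) ≤ τ) l →
         w X ≤ w (X ⊓⁺ l) + s * suc τ
  cut⁺ {X} {l} {s} {τ} len hs =
    ≤-trans (sieve (λ v z → arc z v) X l (All.map (λ {z} h → ≤-trans (miss⁺ X z) (s≤s h)) hs))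
            (+-monoʳ-≤ (w (X ⊓⁺ l)) (*-monoˡ-≤ (suc τ) len))

  cut⁻ : ∀ {X l s τ} → length l ≤ s → All (λ z → w (X ∩⁺ z) ≤ τ) l →
         w X ≤ w (X ⊓⁻ l) + s * suc τ
  cut⁻ {X} {l} {s} {τ} len hs =
    ≤-trans (sieve (λ v z → arc v z) X l (All.map (λ {z} h → ≤-trans (miss⁻ X z) (s≤s h)) hs))
            (+-monoʳ-≤ (w (X ⊓⁻ l)) (*-monoˡ-≤ (suc τ) len))

  ⊓⁺-arcs : ∀ {X l A} → All (_∈ X ⊓⁺ l) A → l ⇒ A
  ⊓⁺-arcs {l = l} hs = All.tabulate λ z∈ → All.map (λ h → All.lookup (all-elim l (∈-∩ʳ h)) z∈) hs

  ⊓⁻-arcs : ∀ {X l A} → All (_∈ X ⊓⁻ l) A → A ⇒ l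
  ⊓⁻-arcs {l = l} hs = All.map (λ h → all-elim l (∈-∩ʳ h)) hs

-- Greedy embedding

-- The situation inside the inductive step: `heavyD` and `heavyA` are the induction hypotheses,
-- `triangle`, `noD` and `noA` the excluded tournaments. `CopyD` and `CopyA` are arbitrary
-- predicates, so that reversing all arcs can keep them unchanged.
record Setting {V : Set} (arc : V → V → Bool) (U : V → Bool) (W : Weight arc U)
               (c s n k : ℕ) : Set₁ where
  open Sets U
  open Weight W
  open Pattern arc
  inU : V → Set
  inU v = U v ≡ true
  field
    tri      : ∀ u v → u ≡ v ⊎ arc u v ≡ true ⊎ arc v u ≡ true
    asym     : ∀ {u v} → u ⟶ v → v ⟶ u → ⊥
    CopyD    : List V → Set
    CopyA    : List V → Set
    lenD     : ∀ {l} → CopyD l → length l ≤ s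
    lenA     : ∀ {l} → CopyA l → length l ≤ s
    nonempty : ∀ {l} → CopyA l → ∃ λ v → ∃ λ l′ → l ≡ v ∷ l′
    heavyD   : ∀ {S} → c < w S → (∀ A → CopyD A → All (_∈ S) A → ⊥) → ⊥
    heavyA   : ∀ {S} → c < w S → (∀ A → CopyA A → All (_∈ S) A → ⊥) → ⊥
    triangle : ∀ {x A B} → CopyD A → CopyD B → inU x → All inU A → All inU B →
               All (x ⟶_) A → A ⇒ B → All (_⟶ x) B → ⊥
    noD      : ∀ {l} → IsD n l → All inU l → ⊥
    noA      : ∀ {u is} → Alternating CopyA k is → AllPairs _◁_ (vtx u ∷ is) →
               All inU (flat (vtx u ∷ is)) → ⊥

-- The number of levels used up by embedding a copy of D_{j+1} greedily.
lev : ℕ → ℕ → ℕ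
lev zero    l = 2 + l
lev (suc j) l = 2 + lev j (lev j l)

module Embed {V : Set} {arc : V → V → Bool} {U : V → Bool} {W : Weight arc U} {c s n k : ℕ}
  (S : Setting arc U W c s n k) where

  open Setting S
  open Calculus arc U tri W

  few⁺ few⁻ : (V → Bool) → ℕ → V → Bool
  few⁺ P t z = w (P ∩⁺ z) ≤ᵇ t
  few⁻ P t z = w (P ∩⁻ z) ≤ᵇ t

  module _ (X : V → Bool) (τ : ℕ → ℕ)
    (hyp⁺ : ∀ l {P} → P ⊑ X → τ (suc l) < w P → w (X ∩ few⁺ P (τ l)) ≤ τ (suc l))
    (hyp⁻ : ∀ l {P} → P ⊑ X → τ (suc l) < w P → w (X ∩ few⁻ P (τ l)) ≤ τ (suc l))
    (grow : ∀ l → suc n * (τ l + τ l) ≤ τ (suc l)) where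

    Heavy : ℕ → (V → Bool) → Set
    Heavy l Q = Q ⊑ X × τ l < w Q

    τ-step : ∀ l → τ l ≤ τ (suc l)
    τ-step l = ≤-trans (m≤m+n (τ l) (τ l)) (≤-trans (m≤m+n _ _) (grow l))

    -- Each of the at most `suc n` sets excludes two light sets of vertices, those with few
    -- out-neighbours and those with few in-neighbours in it. By `grow` these do not exhaust `R`.
    pick : ∀ l {R} Qs → length Qs ≤ suc n → Heavy (2 + l) R → All (Heavy (2 + l)) Qs →
           (∀ {v} → v ∈ R → All (λ Q → τ l < w (Q ∩⁺ v) × τ l < w (Q ∩⁻ v)) Qs → ⊥) → ⊥
    pick l {R} Qs len (R⊑X , R>) hQs kont =
      inhab (remains (sieve good R Qs (All.map bad hQs))
                     (≤-trans (*-monoˡ-≤ (τ (suc l) + τ (suc l)) len) (grow (suc l))) R>)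
            (λ v∈ → kont (∈-∩ˡ v∈) (All.map read (all-elim Qs (∈-∩ʳ v∈))))
      where
      good : V → (V → Bool) → Bool
      good v Q = (τ l <ᵇ w (Q ∩⁺ v)) ∧ (τ l <ᵇ w (Q ∩⁻ v))
      read : ∀ {v Q} → good v Q ≡ true → τ l < w (Q ∩⁺ v) × τ l < w (Q ∩⁻ v)
      read {v} {Q} eq = <ᵇ-elim (∧-left eq) , <ᵇ-elim (∧-right {τ l <ᵇ w (Q ∩⁺ v)} eq)
      bad : ∀ {Q} → Heavy (2 + l) Q → w (R ∩ (λ v → not (good v Q))) ≤ τ (suc l) + τ (suc l)
      bad {Q} (Q⊑X , Q>) = ≤-trans (sub split) (+-mono-≤ (hyp⁺ l Q⊑X Q>′) (hyp⁻ l Q⊑X Q>′))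
        where
        Q>′ : τ (suc l) < w Q
        Q>′ = ≤-<-trans (τ-step (suc l)) Q>
        split : ∀ {v} → v ∈ R ∩ (λ v → not (good v Q)) → v ∈ X ∩ few⁺ Q (τ l) ⊎ v ∈ X ∩ few⁻ Q (τ l)
        split {v} v∈ with <-≤-connex (τ l) (w (Q ∩⁺ v)) | <-≤-connex (τ l) (w (Q ∩⁻ v))
        ... | inj₂ h | _      = inj₁ (∈-∩ (R⊑X (∈-∩ˡ v∈)) (≤ᵇ-intro h))
        ... | inj₁ _ | inj₂ h = inj₂ (∈-∩ (R⊑X (∈-∩ˡ v∈)) (≤ᵇ-intro h))
        ... | inj₁ a | inj₁ b =
          ⊥-elim (not-false (∈-∩ʳ v∈) (∧-intro (<ᵇ-intro a) (<ᵇ-intro b)))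

    side : Bool → V → (V → Bool) → V → Bool
    side true  v P = P ∩⁺ v
    side false v P = P ∩⁻ v

    sides : Bool → List V → (V → Bool) → V → Bool
    sides true  A P = P ⊓⁺ A
    sides false A P = P ⊓⁻ A

    sides-⊑ : ∀ ε {A P} → sides ε A P ⊑ P
    sides-⊑ true  = ∈-∩ˡ
    sides-⊑ false = ∈-∩ˡ

    sides-point : ∀ ε {v P} → side ε v P ⊑ sides ε (v ∷ []) P
    sides-point true  u∈ = ∈-∩ (∈-∩ˡ u∈) (∧-intro (∈-∩ʳ u∈) refl)
    sides-point false u∈ = ∈-∩ (∈-∩ˡ u∈) (∧-intro (∈-∩ʳ u∈) refl)

    sides-node : ∀ ε {v A B P} → sides ε B (sides ε A (side ε v P)) ⊑ sides ε (v ∷ A ++ B) P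
    sides-node true {A = A} {B} u∈ = ∈-∩ (∈-∩ˡ (∈-∩ˡ (∈-∩ˡ u∈)))
      (∧-intro (∈-∩ʳ (∈-∩ˡ (∈-∩ˡ u∈)))
               (all-intro (Allₚ.++⁺ (all-elim A (∈-∩ʳ (∈-∩ˡ u∈))) (all-elim B (∈-∩ʳ u∈)))))
    sides-node false {A = A} {B} u∈ = ∈-∩ (∈-∩ˡ (∈-∩ˡ (∈-∩ˡ u∈)))
      (∧-intro (∈-∩ʳ (∈-∩ˡ (∈-∩ˡ u∈)))
               (all-intro (Allₚ.++⁺ (all-elim A (∈-∩ʳ (∈-∩ˡ u∈))) (all-elim B (∈-∩ʳ u∈)))))

    Signed : Set
    Signed = Bool × (V → Bool)

    -- The sets in `Ps` are reserved for later use: the copy must leave each of them a heavy common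
    -- out- or in-neighbourhood, according to its sign. Going down from `suc j` to `j` adds at most
    -- one reserved set, so `pick` never meets more than `suc n` sets.
    embed : ∀ j l {R} (Ps : List Signed) → length Ps + j ≤ n →
            Heavy (lev j l) R → All (λ P → Heavy (lev j l) (proj₂ P)) Ps →
            (∀ A → IsD j A → All (_∈ R) A →
               All (λ P → τ l < w (sides (proj₁ P) A (proj₂ P))) Ps → ⊥) → ⊥
    embed zero l {R} Ps len hR hPs kont =
      pick l (map proj₂ Ps)
        (≤-trans (≤-reflexive (length-map proj₂ Ps)) (≤-trans (m≤m+n (length Ps) 0) (m≤n⇒m≤1+n len)))
        hR (Allₚ.map⁺ hPs)
        λ {v} v∈R hs → kont (v ∷ []) (point v) (v∈R ∷ [])
          (All.map (λ {P} → out (proj₁ P)) (Allₚ.map⁻ hs))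
      where
      out : ∀ ε {v P} → τ l < w (P ∩⁺ v) × τ l < w (P ∩⁻ v) → τ l < w (sides ε (v ∷ []) P)
      out true  (h , _) = <-≤-trans h (mono (sides-point true))
      out false (_ , h) = <-≤-trans h (mono (sides-point false))
    embed (suc j) l {R} Ps len hR hPs kont =
      pick l₂ (R ∷ map proj₂ Ps) len₀ hR (hR ∷ Allₚ.map⁺ hPs) step
      where
      l₁ l₂ : ℕ
      l₁ = lev j l
      l₂ = lev j l₁
      len′ : suc (length Ps + j) ≤ n
      len′ = ≤-trans (≤-reflexive (sym (+-suc (length Ps) j))) len
      len₀ : suc (length (map proj₂ Ps)) ≤ suc n
      len₀ = s≤s (≤-trans (≤-reflexive (length-map proj₂ Ps)) (≤-trans (m≤m+n _ _) len))
      heavy-side : ∀ ε {v P} → P ⊑ X → τ l₂ < w (P ∩⁺ v) × τ l₂ < w (P ∩⁻ v) → Heavy l₂ (side ε v P)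
      heavy-side true  P⊑X (h , _) = P⊑X ∘ ∈-∩ˡ , h
      heavy-side false P⊑X (_ , h) = P⊑X ∘ ∈-∩ˡ , h
      heavy-side′ : ∀ ε {v P} → Heavy (lev (suc j) l) P × τ l₂ < w (P ∩⁺ v) × τ l₂ < w (P ∩⁻ v) →
                    Heavy l₂ (side ε v P)
      heavy-side′ ε ((P⊑X , _) , h) = heavy-side ε P⊑X h
      heavy-sides : ∀ ε {A P} → Heavy l₂ P × τ l₁ < w (sides ε A P) → Heavy l₁ (sides ε A P)
      heavy-sides ε ((P⊑X , _) , h) = (λ u∈ → P⊑X (sides-⊑ ε u∈)) , h
      step : ∀ {v} → v ∈ R → All (λ Q → τ l₂ < w (Q ∩⁺ v) × τ l₂ < w (Q ∩⁻ v)) (R ∷ map proj₂ Ps) → ⊥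
      step {v} v∈R (hv ∷ hs) =
        -- `A` is found among the out-neighbours of `v`. The in-neighbours are reserved meanwhile
        -- with sign `true`, so that a heavy part dominated by `A` remains to host `B`.
        embed j l₁ ((true , R ∩⁻ v) ∷ Ps₁) len₁ (heavy-side true (proj₁ hR) hv)
          (heavy-side false (proj₁ hR) hv ∷ hPs₁)
          λ { A dA A⊆ (hR₂ ∷ hPs₂) →
            embed j l (map (λ P → proj₁ P , sides (proj₁ P) A (proj₂ P)) Ps₁) (len₂ A)
              (proj₁ hR ∘ ∈-∩ˡ ∘ ∈-∩ˡ , hR₂)
              (Allₚ.map⁺ (All.zipWith (λ {P} → heavy-sides (proj₁ P)) (hPs₁ , hPs₂)))
              λ B dB B⊆ hPs₃ →
                kont (v ∷ A ++ B)
                  (node v dA dB (All.map ∈-∩ʳ A⊆) (⊓⁺-arcs B⊆) (All.map (∈-∩ʳ ∘ ∈-∩ˡ) B⊆))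
                  (v∈R ∷ Allₚ.++⁺ (All.map ∈-∩ˡ A⊆) (All.map (∈-∩ˡ ∘ ∈-∩ˡ) B⊆))
                  (All.map (λ {P} h → <-≤-trans h (mono (sides-node (proj₁ P))))
                    (Allₚ.map⁻ (Allₚ.map⁻ hPs₃))) }
        where
        Ps₁ : List Signed
        Ps₁ = map (λ P → proj₁ P , side (proj₁ P) v (proj₂ P)) Ps
        hPs₁ : All (λ P → Heavy l₂ (proj₂ P)) Ps₁
        hPs₁ = Allₚ.map⁺ (All.zipWith (λ {P} → heavy-side′ (proj₁ P))
                                      (hPs , Allₚ.map⁻ hs))
        lenPs₁ : length Ps₁ ≡ length Ps
        lenPs₁ = length-map _ Ps
        len₁ : suc (length Ps₁ + j) ≤ n
        len₁ = subst (λ m → suc (m + j) ≤ n) (sym lenPs₁) len′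
        len₂ : ∀ A → length (map (λ P → proj₁ P , sides (proj₁ P) A (proj₂ P)) Ps₁) + j ≤ n
        len₂ A = subst (λ m → m + j ≤ n) (sym (trans (length-map _ Ps₁) lenPs₁)) (<⇒≤ len′)

    embedding : Heavy (lev n 0) X → ⊥
    embedding hX = embed n 0 [] ≤-refl hX [] λ A dA A⊆ _ → noD dA (All.map univ A⊆)

-- Blocks with large common out-neighbourhood

length-concatMap≤ : ∀ {A B : Set} (f : A → List B) {b} {as} →
                    All (λ a → length (f a) ≤ b) as → length (concatMap f as) ≤ length as * b
length-concatMap≤ f []               = z≤n
length-concatMap≤ f {as = a ∷ as} (h ∷ hs) =
  ≤-trans (≤-reflexive (length-++ (f a))) (+-mono-≤ h (length-concatMap≤ f hs))

All×Any : ∀ {A : Set} {P Q : A → Set} {xs} → All P xs → Any Q xs → Any (λ x → P x × Q x) xs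
All×Any (p ∷ ps) (here q)  = here (p , q)
All×Any (p ∷ ps) (there q) = there (All×Any ps q)

module Thresholds (c s n k : ℕ) where

  -- One level pays for all demands made on it: `G x` for the continuation, `s * suc x + ℓ` and `c`
  -- for `light`, `suc n * (x + x)` for `grow`, and `x` for monotonicity.
  step : ℕ → (ℕ → ℕ) → ℕ → ℕ
  step ℓ G x = G x + (s * suc x + ℓ + (c + (suc n * (x + x) + x)))

  levels : ℕ → (ℕ → ℕ) → ℕ → ℕ → ℕ
  levels ℓ G b zero    = b
  levels ℓ G b (suc l) = step ℓ G (levels ℓ G b l)

  -- The level at which a link of the chain appears is not known in advance, so every level must
  -- afford the remaining `r` links with itself as the new base.
  chainBound : ℕ → ℕ → (ℕ → ℕ) → ℕ → ℕ
  chainBound ℓ zero    G b = G b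
  chainBound ℓ (suc r) G b = levels ℓ (chainBound ℓ r G) b (lev n 0)

  -- With `J` branches of at most `f` vertices, each prolonged by up to `M` choices of one vertex,
  -- the next block has to dominate `J * M * suc f` vertices, at a cost of `suc κ` apiece.
  combBound : ℕ → ℕ → ℕ → ℕ → ℕ → ℕ
  combBound κ M zero    J f = 0
  combBound κ M (suc m) J f = (c + J * M * suc f * suc κ) + combBound κ M m (J * M) (s + suc f)

  -- `slack t` bounds the wrong neighbourhoods between the set of single vertices and the sets of
  -- blocks; `spread t` is the weight that `k` successive blocks can cut from the former.
  slack spread weightBound : ℕ → ℕ
  slack t = c + s * suc t + t
  spread t = k * (s * suc (slack t))
  weightBound t = spread t + c + combBound (slack t) (suc (spread t)) k 1 0

  forwardBound : ℕ → ℕ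
  forwardBound ℓ = chainBound ℓ (suc k) (λ t → weightBound t + (s * suc c + ℓ)) 0

  G≤step : ∀ ℓ G x → G x ≤ step ℓ G x
  G≤step ℓ G x = m≤m+n _ _

  light≤step : ∀ ℓ G x → s * suc x + ℓ ≤ step ℓ G x
  light≤step ℓ G x = ≤-trans (m≤m+n _ _) (m≤n+m _ (G x))

  c≤step : ∀ ℓ G x → c ≤ step ℓ G x
  c≤step ℓ G x = ≤-trans (m≤m+n c _) (≤-trans (m≤n+m _ (s * suc x + ℓ)) (m≤n+m _ (G x)))

  grow≤step : ∀ ℓ G x → suc n * (x + x) ≤ step ℓ G x
  grow≤step ℓ G x = ≤-trans (m≤m+n _ x) (≤-trans (m≤n+m _ c)
                      (≤-trans (m≤n+m _ (s * suc x + ℓ)) (m≤n+m _ (G x))))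

  id≤step : ∀ ℓ G x → x ≤ step ℓ G x
  id≤step ℓ G x = ≤-trans (m≤n+m x (suc n * (x + x))) (≤-trans (m≤n+m _ c)
                    (≤-trans (m≤n+m _ (s * suc x + ℓ)) (m≤n+m _ (G x))))

  b≤levels : ∀ ℓ G b l → b ≤ levels ℓ G b l
  b≤levels ℓ G b zero    = ≤-refl
  b≤levels ℓ G b (suc l) = ≤-trans (b≤levels ℓ G b l) (id≤step ℓ G _)

module Forward {V : Set} {arc : V → V → Bool} {U : V → Bool} {W : Weight arc U} {c s n k : ℕ}
  (S : Setting arc U W c s n k) where

  open Setting S
  open Calculus arc U tri W
  open Embed S using (few⁺; few⁻; embedding)
  open Thresholds c s n k

  Below : ℕ → (V → Bool) → (V → Bool) → Set
  Below t Z Y = ∀ z → z ∈ Z → w (Y ∩⁺ z) ≤ t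

  ⇒-++⁻ : ∀ A {B Z} → Z ⇒ A ++ B → Z ⇒ A × Z ⇒ B
  ⇒-++⁻ A h = All.map (proj₁ ∘ Allₚ.++⁻ A) h , All.map (proj₂ ∘ Allₚ.++⁻ A) h

  ⇒-flat : ∀ is {Z} → Z ⇒ flat is → All (blk Z ◁_) is
  ⇒-flat []       h = []
  ⇒-flat (i ∷ is) h = proj₁ (⇒-++⁻ (verts i) h) ∷ ⇒-flat is (proj₂ (⇒-++⁻ (verts i) h))

  module _ (κ M : ℕ) where

    record Branch (a f : ℕ) (Vs : List (V → Bool)) (is : List (Item V)) : Set where
      field
        shape   : Alternating CopyA a is
        ordered : AllPairs _◁_ is
        short   : length (flat is) ≤ f
        inside  : All inU (flat is)
        sparse  : All (λ x → All (λ X → w (X ∩⁺ x) ≤ κ) Vs) (flat is)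
    open Branch

    -- The branches are all the choices of the last vertices of the comb made so far; every vertex
    -- of N extends one of them.  Blocks are chosen to the left of all branches at once.
    comb : ∀ {a f J} Vs N jobs → a + length Vs ≡ k →
           length Vs * (s * suc κ) < w N → w N ≤ M →
           length jobs ≤ J → All (Branch a f Vs) jobs →
           (∀ {u} → u ∈ N → Any (λ is → All (vtx u ◁_) is) jobs) →
           (∀ {u} → u ∈ N → All (λ X → w (X ∩⁺ u) ≤ κ) Vs) →
           All (λ X → Below κ X N) Vs → AllPairs (Below κ) Vs →
           All (λ X → combBound κ M (length Vs) J f < w X) Vs → ⊥
    -- All blocks are placed: any vertex of `N` fits to the left of some branch and completes it to
    -- the forbidden pattern.
    comb {a} [] N jobs len N> _ _ hJobs cover _ _ _ _ =
      inhab N> λ u∈ → finish u∈ (All×Any hJobs (cover u∈))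
      where
      finish : ∀ {f u jobs} → u ∈ N → Any (λ is → Branch a f [] is × All (vtx u ◁_) is) jobs → ⊥
      finish u∈ (there h)          = finish u∈ h
      finish u∈ (here (br , left)) =
        noA (subst (λ m → Alternating CopyA m _) (trans (sym (+-identityʳ a)) len) (shape br))
            (left ∷ ordered br) (univ u∈ ∷ inside br)
    comb {a} {f} {J} (X ∷ Vs) N jobs len N> N≤ lenJ hJobs cover hN (hX ∷ hVs) (pX ∷ pVs) (X> ∷ Vs>) =
      heavyA (remains cutX (m≤m+n _ _) X>) λ Z cZ Z⊆ →
        let Z⊆X : All (_∈ X) Z
            Z⊆X = All.map ∈-∩ˡ Z⊆
            Z⇒pre : All (λ p → Z ⇒ flatPre p) pre
            Z⇒pre = All.tabulate λ p∈ → All.map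
              (λ h → All.lookup (Allₚ.map⁻ (Allₚ.concat⁻ h)) p∈) (⊓⁻-arcs {X} {all-pre} Z⊆)
            cutN : w N ≤ w (N ⊓⁻ Z) + s * suc κ
            cutN = cut⁻ (lenA cZ) (All.map (hX _) Z⊆X)
        in comb Vs (N ⊓⁻ Z) (map (extend Z) pre)
             (trans (sym (+-suc a (length Vs))) len)
             (remains cutN (≤-reflexive (+-comm (length Vs * (s * suc κ)) _)) N>)
             (≤-trans w-∩ N≤)
             (≤-trans (≤-reflexive (length-map (extend Z) pre)) lenPre)
             (Allₚ.map⁺ (All.zipWith (λ (h , g) → newBranch cZ Z⊆X h g) (hPre , Z⇒pre)))
             (λ u∈ → Anyₚ.map⁺ (Any.map (newCover cZ u∈)
               (All×Any Z⇒pre (coverPre (∈-∩ˡ u∈)))))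
             (λ u∈ → All.tail (hN (∈-∩ˡ u∈)))
             (All.map (λ h z z∈ → ≤-trans (w-∩-mono ∈-∩ˡ) (h z z∈)) hVs)
             pVs
             (All.map (≤-<-trans (m≤n+m _ _)) Vs>)
      where
      -- The vertices of `N` that extend a given branch are dominated by at most `M` of them,
      -- `Ys is`. Each of these prolongs the branch, so every other vertex of the part receives a
      -- backward arc from one of them.
      part : List (Item V) → V → Bool
      part is = N ∩ (λ u → all (before u) is)
      Ys : List (Item V) → List V
      Ys is = proj₁ (dom (part is))
      Pre : Set
      Pre = V × List (Item V)
      flatPre : Pre → List V
      flatPre (y , is) = y ∷ flat is
      pre : List Pre
      pre = concatMap (λ is → map (_, is) (Ys is)) jobs
      all-pre : List V
      all-pre = concatMap flatPre pre
      extend : List V → Pre → List (Item V)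
      extend Z (y , is) = blk Z ∷ vtx y ∷ is
      lenYs : ∀ is → length (map (_, is) (Ys is)) ≤ M
      lenYs is = ≤-trans (≤-reflexive (length-map (_, is) (Ys is)))
                   (≤-trans (proj₁ (proj₂ (proj₂ (dom (part is))))) (≤-trans w-∩ N≤))
      lenPre : length pre ≤ J * M
      lenPre = ≤-trans (length-concatMap≤ _ {as = jobs} (All.universal lenYs jobs)) (*-monoˡ-≤ M lenJ)
      PreBranch : Pre → Set
      PreBranch (y , is) = y ∈ part is × Branch a f (X ∷ Vs) is
      hPre : All PreBranch pre
      hPre = Allₚ.concat⁺ (Allₚ.map⁺ (All.map
        (λ {is} br → Allₚ.map⁺ (All.map (λ y∈ → y∈ , br) (proj₁ (proj₂ (dom (part is)))))) hJobs))
      lenAll : length all-pre ≤ J * M * suc f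
      lenAll = ≤-trans (length-concatMap≤ flatPre {as = pre} (All.map (λ (_ , br) → s≤s (short br)) hPre))
                       (*-monoˡ-≤ (suc f) lenPre)
      cutX : w X ≤ w (X ⊓⁻ all-pre) + J * M * suc f * suc κ
      cutX = cut⁻ lenAll (Allₚ.concat⁺ (Allₚ.map⁺ (All.map
        (λ (y∈ , br) → All.head (hN (∈-∩ˡ y∈)) ∷ All.map All.head (sparse br)) hPre)))
      newBranch : ∀ {Z p} → CopyA Z → All (_∈ X) Z → PreBranch p → Z ⇒ flatPre p →
                  Branch (suc a) (s + suc f) Vs (extend Z p)
      newBranch {Z} {y , is} cZ Z⊆X (y∈ , br) Z⇒ = record
        { shape   = cons cZ (shape br)
        ; ordered = ⇒-flat (vtx y ∷ is) Z⇒ ∷ all-elim is (∈-∩ʳ y∈) ∷ ordered br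
        ; short   = ≤-trans (≤-reflexive (length-++ Z)) (+-mono-≤ (lenA cZ) (s≤s (short br)))
        ; inside  = Allₚ.++⁺ (All.map univ Z⊆X) (univ y∈ ∷ inside br)
        ; sparse  = Allₚ.++⁺ (All.map (λ z∈ → All.map (λ h → h _ z∈) pX) Z⊆X)
                      (All.tail (hN (∈-∩ˡ y∈)) ∷ All.map All.tail (sparse br)) }
      Extends : V → Pre → Set
      Extends u (y , is) = (y ≡ u ⊎ y ⟶ u) × All (vtx u ◁_) is
      coverPre : ∀ {u} → u ∈ N → Any (Extends u) pre
      coverPre {u} u∈ = Anyₚ.concat⁺ (Anyₚ.map⁺ (Any.map
        (λ {is} left → Anyₚ.map⁺ (Any.map (_, left)
          (proj₂ (proj₂ (proj₂ (dom (part is)))) (∈-∩ u∈ (all-intro left))))) (cover u∈)))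
      newCover : ∀ {Z u p} → CopyA Z → u ∈ N ⊓⁻ Z → Z ⇒ flatPre p × Extends u p →
                 All (vtx u ◁_) (extend Z p)
      newCover cZ u∈ (_ , inj₂ yu , left) = ∈-∩ʳ u∈ ∷ yu ∷ left
      -- A vertex still in `N` points to `Z`, whereas `Z` points to all chosen vertices; as `Z` is
      -- not empty, `u` is not itself a chosen one.
      newCover {Z} cZ u∈ (Z⇒ , inj₁ refl , left) with nonempty cZ
      ... | z , Z′ , refl = ⊥-elim (asym (∧-left (∈-∩ʳ u∈)) (All.head (All.head Z⇒)))

  module _ (ℓ : ℕ) (X : V → Bool)
    (kont : ∀ A → CopyD A → All (_∈ X) A → ℓ < w (X ⊓⁺ A) → ⊥) where

    -- Otherwise these vertices contain a copy `A` from `CopyD`; cutting the light in-neighbourhoods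
    -- of its vertices out of `Y` leaves a heavy common out-neighbourhood, contrary to `kont`.
    light : ∀ {Y t} → Y ⊑ X → s * suc t + ℓ < w Y → w (X ∩ few⁻ Y t) ≤ c
    light {Y} {t} Y⊑X Y> with <-≤-connex c (w (X ∩ few⁻ Y t))
    ... | inj₂ h = h
    ... | inj₁ h = ⊥-elim (heavyD h λ A cA A⊆ → kont A cA (All.map ∈-∩ˡ A⊆)
            (<-≤-trans (remains (cut⁺ (lenD cA) (All.map (≤ᵇ-elim ∘ ∈-∩ʳ) A⊆))
                                (≤-reflexive (+-comm ℓ _)) Y>)
                       (w-∩-mono Y⊑X)))

    -- The greedy embedding must fail. Its hypothesis on in-neighbourhoods is guaranteed by `light`,
    -- and a failure of the one on out-neighbourhoods is exactly a pair `Y`, `Z` as wanted, at the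
    -- level of the failure.
    split : ∀ G b {X′} → X′ ⊑ X → levels ℓ G b (lev n 0) < w X′ →
            (∀ t {Y Z} → b ≤ t → Y ⊑ X′ → Z ⊑ X′ → G t < w Y → G t < w Z → Below t Z Y → ⊥) → ⊥
    split G b {X′} X′⊑X X′> found = embedding X′ τ hyp⁺ hyp⁻ (λ l → grow≤step ℓ G (τ l)) ((λ v∈ → v∈) , X′>)
      where
      τ : ℕ → ℕ
      τ = levels ℓ G b
      hyp⁺ : ∀ l {P} → P ⊑ X′ → τ (suc l) < w P → w (X′ ∩ few⁺ P (τ l)) ≤ τ (suc l)
      hyp⁺ l {P} P⊑ P> with <-≤-connex (τ (suc l)) (w (X′ ∩ few⁺ P (τ l)))
      ... | inj₂ h = h
      ... | inj₁ h = ⊥-elim (found (τ l) (b≤levels ℓ G b l) P⊑ ∈-∩ˡ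
              (≤-<-trans (G≤step ℓ G (τ l)) P>) (≤-<-trans (G≤step ℓ G (τ l)) h)
              (λ z z∈ → ≤ᵇ-elim (∈-∩ʳ z∈)))
      hyp⁻ : ∀ l {P} → P ⊑ X′ → τ (suc l) < w P → w (X′ ∩ few⁻ P (τ l)) ≤ τ (suc l)
      hyp⁻ l {P} P⊑ P> = ≤-trans (w-∩-mono X′⊑X) (≤-trans
        (light (λ v∈ → X′⊑X (P⊑ v∈)) (≤-<-trans (light≤step ℓ G (τ l)) P>)) (c≤step ℓ G (τ l)))

    record Chain (G : ℕ → ℕ) (b r : ℕ) (X′ : V → Bool) : Set where
      field
        t      : ℕ
        Vs     : List (V → Bool)
        Y      : V → Bool
        b≤t    : b ≤ t
        len    : length Vs ≡ r
        Y⊑     : Y ⊑ X′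
        Y>     : G t < w Y
        Vs⊑    : All (_⊑ X′) Vs
        Vs>    : All (λ Z → G t < w Z) Vs
        linked : AllPairs (Below t) Vs
        last   : All (λ Z → Below t Z Y) Vs

    chain : ∀ r G b {X′} → X′ ⊑ X → chainBound ℓ r G b < w X′ → (Chain G b r X′ → ⊥) → ⊥
    chain zero G b {X′} X′⊑X X′> found = found record
      { t = b ; Vs = [] ; Y = X′ ; b≤t = ≤-refl ; len = refl ; Y⊑ = λ v∈ → v∈ ; Y> = X′>
      ; Vs⊑ = [] ; Vs> = [] ; linked = [] ; last = [] }
    chain (suc r) G b {X′} X′⊑X X′> found =
      split (chainBound ℓ r G) b X′⊑X X′> λ t {Y} {Z} b≤t Y⊑ Z⊑ Y> Z> below →
        -- Trimming ensures `w Y₁ ≤ w Z`. The final level `C.t` is determined only inside `Y₁`, and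
        -- `Z` has to be heavy for it as well.
        let Y₁ , Y₁⊑ , Y₁> , Y₁≤ = trim Y>
            below₁ : ∀ {t′ Y₂} → t ≤ t′ → Y₂ ⊑ Y₁ → Below t′ Z Y₂
            below₁ t≤ Y₂⊑ z z∈ = ≤-trans (w-∩-mono (λ v∈ → Y₁⊑ (Y₂⊑ v∈))) (≤-trans (below z z∈) t≤)
        in chain r G t (λ v∈ → X′⊑X (Y⊑ (Y₁⊑ v∈))) Y₁> λ C →
          let module C = Chain C in found record
            { t = C.t ; Vs = Z ∷ C.Vs ; Y = C.Y ; b≤t = ≤-trans b≤t C.b≤t ; len = cong suc C.len
            ; Y⊑ = λ v∈ → Y⊑ (Y₁⊑ (C.Y⊑ v∈)) ; Y> = C.Y>
            ; Vs⊑ = Z⊑ ∷ All.map (λ {Z′} (Z′⊑ : Z′ ⊑ Y₁) {v} v∈ → Y⊑ (Y₁⊑ (Z′⊑ v∈))) C.Vs⊑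
            ; Vs> = <-≤-trans C.Y> (≤-trans (mono C.Y⊑) (≤-trans Y₁≤ Z>)) ∷ C.Vs>
            ; linked = All.map (λ {Z′} (Z′⊑ : Z′ ⊑ Y₁) → below₁ C.b≤t Z′⊑) C.Vs⊑ ∷ C.linked
            ; last = below₁ C.b≤t C.Y⊑ ∷ C.last }

    forward′ : forwardBound ℓ < w X → ⊥
    forward′ X> = chain (suc k) _ 0 (λ v∈ → v∈) X> λ C → run (Chain.t C) (Chain.Vs C) (Chain.Y C)
      (Chain.len C) (Chain.Y⊑ C) (Chain.Y> C) (Chain.Vs⊑ C) (Chain.Vs> C) (Chain.linked C) (Chain.last C)
      where
      G : ℕ → ℕ
      G t = weightBound t + (s * suc c + ℓ)
      run : ∀ t Vs Y → length Vs ≡ suc k → Y ⊑ X → G t < w Y → All (_⊑ X) Vs → All (λ Z → G t < w Z) Vs →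
            AllPairs (Below t) Vs → All (λ Z → Below t Z Y) Vs → ⊥
      run t (Z ∷ Vs) Y len Y⊑ Y> (Z⊑ ∷ Vs⊑) (Z> ∷ Vs>) (pZ ∷ pVs) (lZ ∷ lVs) =
        comb (slack t) (suc (spread t)) Vs N ([] ∷ []) (suc-injective len)
          (subst (λ m → m * (s * suc (slack t)) < w N) (sym (suc-injective len)) N>) N≤
          (s≤s z≤n) (record { shape = [] ; ordered = [] ; short = z≤n ; inside = [] ; sparse = [] } ∷ [])
          (λ _ → here [])
          (λ u∈ → All.map (few (N⊑ u∈)) pZ)
          (All.map (λ h z z∈ → ≤-trans (w-∩-mono (λ v∈ → ∈-∩ˡ (N⊑ v∈))) (≤-trans (h z z∈) t≤)) lVs)
          (AllPairs.map (λ h z z∈ → ≤-trans (h z z∈) t≤) pVs)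
          (All.map (≤-<-trans comb≤) Vs>)
        where
        -- The first set `Z` of the chain serves as a filter only: by `light` most of `Y` has a
        -- heavy in-neighbourhood in `Z`, and `few` uses it to control the out-neighbourhoods in the
        -- other sets.
        Y′ : V → Bool
        Y′ = Y ∩ (λ x → c <ᵇ w (Z ∩⁻ x))
        t≤ : t ≤ slack t
        t≤ = m≤n+m t _
        comb≤ : combBound (slack t) (suc (spread t)) (length Vs) 1 0 ≤ G t
        comb≤ = subst (λ m → combBound (slack t) (suc (spread t)) m 1 0 ≤ G t) (sym (suc-injective len))
                      (≤-trans (m≤n+m _ (spread t + c)) (m≤m+n _ _))
        Y′> : spread t < w Y′
        Y′> = remains (≤-trans (sub split′) (+-monoʳ-≤ (w Y′)
                 (light {t = c} Z⊑ (≤-<-trans (m≤n+m _ (weightBound t)) Z>))))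
                 (≤-trans (m≤m+n (spread t + c) _) (m≤m+n _ _)) Y>
          where
          split′ : ∀ {v} → v ∈ Y → v ∈ Y′ ⊎ v ∈ X ∩ few⁻ Z c
          split′ {v} v∈ with <-≤-connex c (w (Z ∩⁻ v))
          ... | inj₁ h = inj₁ (∈-∩ v∈ (<ᵇ-intro h))
          ... | inj₂ h = inj₂ (∈-∩ (Y⊑ v∈) (≤ᵇ-intro h))
        trimmed = trim Y′>
        N : V → Bool
        N = proj₁ trimmed
        N⊑ : N ⊑ Y′
        N⊑ = proj₁ (proj₂ trimmed)
        N> : spread t < w N
        N> = proj₁ (proj₂ (proj₂ trimmed))
        N≤ : w N ≤ suc (spread t)
        N≤ = proj₂ (proj₂ (proj₂ trimmed))
        -- A heavy out-neighbourhood would close a triangle x → A → B → x: take `B` among the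
        -- in-neighbours of `x` in `Z`, and `A` among its out-neighbours in `X′` that dominate `B`.
        few : ∀ {x X′} → x ∈ Y′ → Below t Z X′ → w (X′ ∩⁺ x) ≤ slack t
        few {x} {X′} x∈ below with <-≤-connex (slack t) (w (X′ ∩⁺ x))
        ... | inj₂ h = h
        ... | inj₁ h = ⊥-elim (heavyD (<ᵇ-elim (∈-∩ʳ x∈)) λ B cB B⊆ →
          heavyD (remains (cut⁻ (lenD cB)
                    (All.map (λ b∈ → ≤-trans (w-∩-mono ∈-∩ˡ) (below _ (∈-∩ˡ b∈))) B⊆)) (m≤m+n _ t) h)
            λ A cA A⊆ → triangle cA cB (univ x∈) (All.map univ A⊆) (All.map univ B⊆)
              (All.map (∈-∩ʳ ∘ ∈-∩ˡ) A⊆) (⊓⁻-arcs A⊆) (All.map ∈-∩ʳ B⊆))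

  forward : ∀ ℓ {X} → forwardBound ℓ < w X →
            (∀ A → CopyD A → All (_∈ X) A → ℓ < w (X ⊓⁺ A) → ⊥) → ⊥
  forward ℓ {X} X> kont = forward′ ℓ X kont X>

-- Reversal and two-sided splitting

swap-tri : ∀ {A B C : Set} → A ⊎ B ⊎ C → A ⊎ C ⊎ B
swap-tri (inj₁ a)        = inj₁ a
swap-tri (inj₂ (inj₁ b)) = inj₂ (inj₂ b)
swap-tri (inj₂ (inj₂ c)) = inj₂ (inj₁ c)

-- `dom` for the reversed arcs; no other field of `Weight` mentions the direction of arcs.
Absorbing : ∀ {V : Set} {arc : V → V → Bool} {U : V → Bool} → Weight arc U → Set
Absorbing {arc = arc} {U} W = ∀ X → ∃ λ Y → All (_∈ X) Y × length Y ≤ w X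
                            × (∀ {u} → u ∈ X → Any (λ y → y ≡ u ⊎ arc u y ≡ true) Y)
  where
  open Sets U
  open Weight W

flipWeight : ∀ {V : Set} {arc : V → V → Bool} {U : V → Bool} (W : Weight arc U) →
             Absorbing W → Weight (flip arc) U
flipWeight W absorb = record
  { w = w ; mono = mono ; sub = sub ; sing = sing ; inhab = inhab ; dom = absorb ; trim = trim }
  where open Weight W

All-swap : ∀ {A B : Set} {R : A → B → Set} {xs ys} →
           All (λ x → All (R x) ys) xs → All (λ y → All (λ x → R x y) xs) ys
All-swap h = All.tabulate λ y∈ → All.map (λ g → All.lookup g y∈) h

module Reversal {V : Set} (arc : V → V → Bool) where

  open Pattern arc
  module Op = Pattern (flip arc)

  -- The tournaments D are self-converse, with the two copies exchanged. The vertex list gets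
  -- permuted, hence the transfer of `All`.
  unflip-D : ∀ {j l} → Op.IsD j l → ∃ λ l′ → IsD j l′ × (∀ {P : V → Set} → All P l → All P l′)
  unflip-D (Op.point v) = v ∷ [] , point v , λ h → h
  unflip-D (Op.node {A = A} v dA dB vA AB Bv) with unflip-D dA | unflip-D dB
  ... | A′ , dA′ , fA | B′ , dB′ , fB =
    v ∷ B′ ++ A′ ,
    node v dB′ dA′ (fB Bv) (All.map fA (fB (All-swap AB))) (fA vA) ,
    λ { (p ∷ ps) → p ∷ Allₚ.++⁺ (fB (Allₚ.++⁻ʳ A ps)) (fA (Allₚ.++⁻ˡ A ps)) }

  unflip-◁ : ∀ i j → i Op.◁ j → j ◁ i
  unflip-◁ (vtx u) (vtx v) h = h
  unflip-◁ (vtx u) (blk Z) h = All.map (_∷ []) (all-elim Z h)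
  unflip-◁ (blk Z) (vtx v) h = all-intro (All.map All.head h)
  unflip-◁ (blk Z) (blk Y) h = All-swap h

  -- The pattern of A is self-converse when read from right to left. `vtx u ∷ acc` is the part
  -- already reversed; the blocks stay as they are.
  reverse-comb : ∀ {P : List V → Set} {Q : V → Set} {a b u acc is} →
    Alternating P a acc → Alternating P b is →
    AllPairs _◁_ (vtx u ∷ acc) → AllPairs Op._◁_ is → All (λ i → All (i ◁_) (vtx u ∷ acc)) is →
    All Q (flat (vtx u ∷ acc)) → All Q (flat is) →
    ∃ λ v → ∃ λ js → Alternating P (b + a) js × AllPairs _◁_ (vtx v ∷ js) × All Q (flat (vtx v ∷ js))
  reverse-comb sacc [] pacc _ _ qacc _ = _ , _ , sacc , pacc , qacc
  reverse-comb {P} {a = a} {suc b} {u} {acc} sacc (cons {Z = Z} {y} {is} pZ sis) pacc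
    ((Zy ∷ Zis) ∷ yis ∷ pis) (Z◁ ∷ y◁ ∷ is◁) qacc qis
    with Allₚ.++⁻ˡ Z qis | Allₚ.++⁻ʳ Z qis
  ... | qZ | qy ∷ qis′
    with reverse-comb {u = y} (cons {v = u} pZ sacc) sis
           ((unflip-◁ (blk Z) (vtx y) Zy ∷ y◁) ∷ Z◁ ∷ pacc) pis
           (All.zipWith (λ {i} (f , g , h) → unflip-◁ (vtx y) i f ∷ unflip-◁ (blk Z) i g ∷ h)
                        (yis , All.zip (Zis , is◁)))
           (qy ∷ Allₚ.++⁺ qZ qacc) qis′
  ... | v , js , sjs , pjs , qjs = v , js , subst (λ m → Alternating P m js) (+-suc b a) sjs , pjs , qjs

flipSetting : ∀ {V : Set} {arc : V → V → Bool} {U : V → Bool} {W : Weight arc U} {c s n k} →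
              Setting arc U W c s n k → (absorb : Absorbing W) →
              Setting (flip arc) U (flipWeight W absorb) c s n k
flipSetting {arc = arc} {U} {k = k} S absorb = record
  { tri = λ u v → swap-tri (tri u v) ; asym = asym ; CopyD = CopyD ; CopyA = CopyA
  ; lenD = lenD ; lenA = lenA ; nonempty = nonempty ; heavyD = heavyD ; heavyA = heavyA
  ; triangle = λ cA cB x∈ A⊆ B⊆ xA AB Bx → triangle cB cA x∈ B⊆ A⊆ Bx (All-swap AB) xA
  ; noD = λ d l⊆ → let _ , d′ , f = unflip-D d in noD d′ (f l⊆)
  ; noA = noA′ }
  where
  open Setting S
  open Reversal arc
  noA′ : ∀ {u is} → Alternating CopyA k is → AllPairs Op._◁_ (vtx u ∷ is) →
         All inU (flat (vtx u ∷ is)) → ⊥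
  noA′ {u} {is} alt (left ∷ pairs) (qu ∷ qs)
    with reverse-comb {u = u} [] alt ([] ∷ []) pairs
           (All.map (λ {i} h → unflip-◁ (vtx u) i h ∷ []) left) (qu ∷ []) qs
  ... | v , js , sjs , pjs , qjs =
    noA (subst (λ m → Alternating CopyA m js) (+-identityʳ k) sjs) pjs qjs

module Bound (c s n k : ℕ) where

  open Thresholds c s n k

  bisplitBound : ℕ → ℕ
  bisplitBound ℓ = levels ℓ (λ t → forwardBound ℓ + (ℓ + s * suc t)) 0 (lev n 0)

  fourBound : ℕ → ℕ
  fourBound ℓ = bisplitBound (bisplitBound ℓ)

module Bisplit {V : Set} {arc : V → V → Bool} {U : V → Bool} {W : Weight arc U} {c s n k : ℕ}
  (S : Setting arc U W c s n k) (absorb : Absorbing W) where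

  open Setting S
  open Calculus arc U tri W
  open Embed S using (few⁺; few⁻; embedding)
  open Thresholds c s n k
  open Bound c s n k
  open Forward S using (forward)
  open Forward (flipSetting S absorb) using () renaming (forward to backward)

  -- The embedding must fail. If the vertices with light out-neighbourhood in `P` form a heavy set,
  -- `forward` finds in it a copy with heavy common out-neighbourhood, and most of `P` points to
  -- that copy. The other failure is symmetric, by `backward`.
  bisplit : ∀ ℓ {X} → bisplitBound ℓ < w X →
            (∀ A → CopyD A → All (_∈ X) A → ℓ < w (X ⊓⁻ A) → ℓ < w (X ⊓⁺ A) → ⊥) → ⊥
  bisplit ℓ {X} X> kont = embedding X τ hyp⁺ hyp⁻ (λ l → grow≤step ℓ G (τ l)) ((λ v∈ → v∈) , X>)
    where
    G : ℕ → ℕ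
    G t = forwardBound ℓ + (ℓ + s * suc t)
    τ : ℕ → ℕ
    τ = levels ℓ G 0
    bound≤ : ∀ l → forwardBound ℓ ≤ τ (suc l)
    bound≤ l = ≤-trans (m≤m+n _ _) (G≤step ℓ G (τ l))
    rest≤ : ∀ l → ℓ + s * suc (τ l) ≤ τ (suc l)
    rest≤ l = ≤-trans (m≤n+m _ (forwardBound ℓ)) (G≤step ℓ G (τ l))
    hyp⁺ : ∀ l {P} → P ⊑ X → τ (suc l) < w P → w (X ∩ few⁺ P (τ l)) ≤ τ (suc l)
    hyp⁺ l {P} P⊑ P> with <-≤-connex (τ (suc l)) (w (X ∩ few⁺ P (τ l)))
    ... | inj₂ h = h
    ... | inj₁ h = ⊥-elim (forward ℓ (≤-<-trans (bound≤ l) h) λ A cA A⊆ out →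
            kont A cA (All.map ∈-∩ˡ A⊆)
              (<-≤-trans (remains (cut⁻ (lenD cA) (All.map (≤ᵇ-elim ∘ ∈-∩ʳ) A⊆)) (rest≤ l) P>)
                         (w-∩-mono P⊑))
              (<-≤-trans out (w-∩-mono ∈-∩ˡ)))
    hyp⁻ : ∀ l {P} → P ⊑ X → τ (suc l) < w P → w (X ∩ few⁻ P (τ l)) ≤ τ (suc l)
    hyp⁻ l {P} P⊑ P> with <-≤-connex (τ (suc l)) (w (X ∩ few⁻ P (τ l)))
    ... | inj₂ h = h
    ... | inj₁ h = ⊥-elim (backward ℓ (≤-<-trans (bound≤ l) h) λ A cA A⊆ out →
            kont A cA (All.map ∈-∩ˡ A⊆)
              (<-≤-trans out (w-∩-mono ∈-∩ˡ))
              (<-≤-trans (remains (cut⁺ (lenD cA) (All.map (≤ᵇ-elim ∘ ∈-∩ʳ) A⊆)) (rest≤ l) P>)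
                         (w-∩-mono P⊑)))

  infix 4 _≪_

  record _≪_ (X Y : V → Bool) : Set where
    field
      later   : ∀ {x} → x ∈ X → w (Y ∩⁻ x) ≤ c
      earlier : ∀ {y} → y ∈ Y → w (X ∩⁺ y) ≤ c
  open _≪_ public

  ≪-mono : ∀ {X X′ Y Y′} → X′ ⊑ X → Y′ ⊑ Y → X ≪ Y → X′ ≪ Y′
  ≪-mono X⊑ Y⊑ h = record
    { later   = λ x∈ → ≤-trans (w-∩-mono Y⊑) (later h (X⊑ x∈))
    ; earlier = λ y∈ → ≤-trans (w-∩-mono X⊑) (earlier h (Y⊑ y∈)) }

  ≤c : ∀ {X} → (∀ A → CopyD A → All (_∈ X) A → ⊥) → w X ≤ c
  ≤c {X} h with <-≤-connex c (w X)
  ... | inj₂ g = g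
  ... | inj₁ g = ⊥-elim (heavyD g h)

  -- A heavy set of wrong neighbours would contain a second copy `B`, which forms a forbidden
  -- triangle with `A` and the vertex.
  pivot : ∀ {X A} → CopyD A → All (_∈ X) A → X ⊓⁻ A ≪ X ⊓⁺ A
  pivot {X} {A} cA A⊆ = record
    { later   = λ x∈ → ≤c λ B cB B⊆ →
        triangle cA cB (univ x∈) (All.map univ A⊆) (All.map univ B⊆)
          (all-elim A (∈-∩ʳ x∈)) (⊓⁺-arcs (All.map ∈-∩ˡ B⊆)) (All.map ∈-∩ʳ B⊆)
    ; earlier = λ y∈ → ≤c λ B cB B⊆ →
        triangle cB cA (univ y∈) (All.map univ B⊆) (All.map univ A⊆)
          (All.map ∈-∩ʳ B⊆) (⊓⁻-arcs (All.map ∈-∩ˡ B⊆)) (all-elim A (∈-∩ʳ y∈)) }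

  two : ∀ ℓ {X} → bisplitBound ℓ < w X →
        (∀ {Y Z} → Y ⊑ X → Z ⊑ X → ℓ < w Y → ℓ < w Z → Y ≪ Z → ⊥) → ⊥
  two ℓ X> kont = bisplit ℓ X> λ A cA A⊆ lo hi → kont ∈-∩ˡ ∈-∩ˡ lo hi (pivot cA A⊆)

  four : ∀ ℓ {X} → fourBound ℓ < w X →
         (∀ Ys → length Ys ≡ 4 → All (λ Y → Y ⊑ X) Ys → All (λ Y → ℓ < w Y) Ys → AllPairs _≪_ Ys → ⊥) → ⊥
  four ℓ X> kont =
    two (bisplitBound ℓ) X> λ {P} {Q} P⊑ Q⊑ P> Q> P≪Q →
    two ℓ P> λ {P₁} {P₂} P₁⊑ P₂⊑ P₁> P₂> P₁≪P₂ →
    two ℓ Q> λ {Q₁} {Q₂} Q₁⊑ Q₂⊑ Q₁> Q₂> Q₁≪Q₂ →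
    kont (P₁ ∷ P₂ ∷ Q₁ ∷ Q₂ ∷ []) refl
      ((λ v∈ → P⊑ (P₁⊑ v∈)) ∷ (λ v∈ → P⊑ (P₂⊑ v∈)) ∷ (λ v∈ → Q⊑ (Q₁⊑ v∈)) ∷ (λ v∈ → Q⊑ (Q₂⊑ v∈)) ∷ [])
      (P₁> ∷ P₂> ∷ Q₁> ∷ Q₂> ∷ [])
      ((P₁≪P₂ ∷ ≪-mono P₁⊑ Q₁⊑ P≪Q ∷ ≪-mono P₁⊑ Q₂⊑ P≪Q ∷ [])
        ∷ (≪-mono P₂⊑ Q₁⊑ P≪Q ∷ ≪-mono P₂⊑ Q₂⊑ P≪Q ∷ [])
        ∷ (Q₁≪Q₂ ∷ []) ∷ [] ∷ [])

-- Chains of heavy sets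

data At {A : Set} : ℕ → List A → A → Set where
  here  : ∀ {x xs} → At 0 (x ∷ xs) x
  there : ∀ {i x y xs} → At i xs y → At (suc i) (x ∷ xs) y

at : ∀ {A : Set} {i} (xs : List A) → i < length xs → ∃ (At i xs)
at {i = zero}  (x ∷ xs) _       = x , here
at {i = suc i} (x ∷ xs) (s≤s h) with at xs h
... | y , p = y , there p

At-All : ∀ {A : Set} {P : A → Set} {i xs x} → All P xs → At i xs x → P x
At-All (p ∷ _)  here      = p
At-All (_ ∷ ps) (there q) = At-All ps q

At-AllPairs : ∀ {A : Set} {R : A → A → Set} {i j xs x y} → AllPairs R xs →
              At i xs x → At j xs y → i < j → R x y
At-AllPairs (r ∷ _)  here      (there q) _       = At-All r q
At-AllPairs (_ ∷ rs) (there p) (there q) (s≤s h) = At-AllPairs rs p q h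

All-take : ∀ {A : Set} {P : A → Set} i xs → (∀ {j x} → j < i → At j xs x → P x) → All P (take i xs)
All-take zero    xs       h = []
All-take (suc i) []       h = []
All-take (suc i) (x ∷ xs) h = h (s≤s z≤n) here ∷ All-take i xs (λ j<i p → h (s≤s j<i) (there p))

All-drop : ∀ {A : Set} {P : A → Set} i xs → (∀ {j x} → i ≤ j → At j xs x → P x) → All P (drop i xs)
All-drop zero    []       h = []
All-drop zero    (x ∷ xs) h = h z≤n here ∷ All-drop zero xs (λ _ p → h z≤n (there p))
All-drop (suc i) []       h = []
All-drop (suc i) (x ∷ xs) h = All-drop i xs (λ i≤j p → h (s≤s i≤j) (there p))

At-length : ∀ {A : Set} {i xs} {x : A} → At i xs x → i < length xs
At-length here      = s≤s z≤n
At-length (there p) = s≤s (At-length p)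

module FinalBound (c s n k : ℕ) where

  open Bound c s n k

  -- A set heavier than `cc` stays heavier than `c` after cutting by a copy whose vertices have
  -- `c`-light wrong neighbourhoods. `reserve` adds up the demands of `build`, `between` and
  -- `representatives`.
  cc reserve : ℕ
  cc      = c + s * suc c
  reserve = (c + suc (k * suc s) * suc cc + k * suc cc) + ((c + s * suc cc + 1 * suc cc) + (c + 1 * suc c))

  -- Abstract because its normal form at numerals is astronomically large.
  abstract
    mainBound : ℕ
    mainBound = (k + k) * fourBound reserve

    mainBound≡ : mainBound ≡ (k + k) * fourBound reserve
    mainBound≡ = refl

  comb≤reserve : c + suc (k * suc s) * suc cc + k * suc cc ≤ reserve
  comb≤reserve = m≤m+n _ _

  mid≤reserve : c + s * suc cc + 1 * suc cc ≤ reserve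
  mid≤reserve = ≤-trans (m≤m+n _ _) (m≤n+m _ (c + suc (k * suc s) * suc cc + k * suc cc))

  rep≤reserve : c + 1 * suc c ≤ reserve
  rep≤reserve = ≤-trans (m≤n+m _ (c + s * suc cc + 1 * suc cc)) (m≤n+m _ (c + suc (k * suc s) * suc cc + k * suc cc))

module Final {V : Set} {arc : V → V → Bool} {U : V → Bool} {W : Weight arc U} {c s n k : ℕ}
  (S : Setting arc U W c s n k) (absorb : Absorbing W)
  (N : ℕ) (finite : ∀ (vs : List V) → AllPairs _≢_ vs → length vs ≤ N) where

  open Setting S
  open Calculus arc U tri W
  open Forward S using (⇒-flat)
  open Bound c s n k
  open FinalBound c s n k
  open Bisplit S absorb

  full : V → Bool
  full _ = true

  Layered : Set
  Layered = ∀ (p : V → ℕ) R {a b} → (∀ v → p v ≤ R) → (∀ i → w (λ v → p v ≡ᵇ i) ≤ b) →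
            (∀ vs → All inU vs → AllPairs (λ u v → p u < p v × v ⟶ u) vs → length vs ≤ a) →
            w full ≤ a * b

  c≤cc : c ≤ cc
  c≤cc = m≤m+n _ _

  -- A copy `A` among the out-neighbours in `X` and a copy `B` among the in-neighbours in `Y`
  -- dominated by `A` give the triangle v → A → B → v.
  conflict : ∀ {v X Y} → inU v → X ≪ Y → cc < w (X ∩⁺ v) → cc < w (Y ∩⁻ v) → ⊥
  conflict v∈ X≪Y X> Y> = heavyD (≤-<-trans c≤cc X>) λ A cA A⊆ →
    heavyD (remains (cut⁺ (lenD cA)
             (All.map (λ a∈ → ≤-trans (w-∩-mono ∈-∩ˡ) (later X≪Y (∈-∩ˡ a∈))) A⊆)) ≤-refl Y>)
      λ B cB B⊆ → triangle cA cB v∈ (All.map univ A⊆) (All.map univ B⊆)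
        (All.map ∈-∩ʳ A⊆) (⊓⁺-arcs B⊆) (All.map (∈-∩ʳ ∘ ∈-∩ˡ) B⊆)

  -- If p had a heavy set of wrong neighbours in `Q`, it would contain a copy `B`, and the heavy `M`
  -- would still contain a copy `A` with p → A → B → p. The bounds assumed are `cc` and the
  -- conclusion has `c`, so constants do not deteriorate along the iteration.
  between : ∀ {P M Q} → reserve < w M → (∀ {p} → p ∈ P → w (M ∩⁻ p) ≤ cc) →
            (∀ {q} → q ∈ Q → w (M ∩⁺ q) ≤ cc) → P ≪ Q
  between {P} {M} {Q} M> hP hQ = record
    { later = λ {p} p∈ → ≤c λ B cB B⊆ →
        heavyD (remains (cut⁻ (lenD cB) (All.map (λ b∈ → ≤-trans (w-∩-mono ∈-∩ˡ) (hQ (∈-∩ˡ b∈))) B⊆))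
                 ≤-refl (remains (cut⁺ {l = p ∷ []} ≤-refl (hP p∈ ∷ [])) mid≤reserve M>))
          λ A cA A⊆ → triangle cA cB (univ p∈) (All.map univ A⊆) (All.map univ B⊆)
            (All.map (λ a∈ → ∧-left (∈-∩ʳ (∈-∩ˡ a∈))) A⊆) (⊓⁻-arcs A⊆) (All.map ∈-∩ʳ B⊆)
    ; earlier = λ {q} q∈ → ≤c λ A cA A⊆ →
        heavyD (remains (cut⁺ (lenD cA) (All.map (λ a∈ → ≤-trans (w-∩-mono ∈-∩ˡ) (hP (∈-∩ˡ a∈))) A⊆))
                 ≤-refl (remains (cut⁻ {l = q ∷ []} ≤-refl (hQ q∈ ∷ [])) mid≤reserve M>))
          λ B cB B⊆ → triangle cA cB (univ q∈) (All.map univ A⊆) (All.map univ B⊆)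
            (All.map ∈-∩ʳ A⊆) (⊓⁺-arcs B⊆) (All.map (λ b∈ → ∧-left (∈-∩ʳ (∈-∩ˡ b∈))) B⊆) }

  -- Positions are shifted by one: 0 means that no X in Xs has w (X ∩⁻ v) > cc.
  pos : List (V → Bool) → V → ℕ
  pos []       v = 0
  pos (X ∷ Xs) v with pos Xs v
  ... | suc p = suc (suc p)
  ... | zero  with cc <ᵇ w (X ∩⁻ v)
  ...   | true  = 1
  ...   | false = 0

  pos≤length : ∀ Xs v → pos Xs v ≤ length Xs
  pos≤length []       v = z≤n
  pos≤length (X ∷ Xs) v with pos Xs v | pos≤length Xs v
  ... | suc p | h = s≤s h
  ... | zero  | h with cc <ᵇ w (X ∩⁻ v)
  ...   | true  = s≤s z≤n
  ...   | false = z≤n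

  pos-after : ∀ Xs v {i X} → At i Xs X → pos Xs v ≤ i → w (X ∩⁻ v) ≤ cc
  pos-after (X ∷ Xs) v p h with pos Xs v in eq
  pos-after (X ∷ Xs) v (there p) (s≤s h) | suc q = pos-after Xs v p (≤-trans (≤-reflexive eq) h)
  pos-after (X ∷ Xs) v (there p) h | zero = pos-after Xs v p (≤-trans (≤-reflexive eq) z≤n)
  pos-after (X ∷ Xs) v here h | zero with <-≤-connex cc (w (X ∩⁻ v))
  ... | inj₂ g = g
  ... | inj₁ g with cc <ᵇ w (X ∩⁻ v) | <ᵇ-intro g
  pos-after (X ∷ Xs) v here () | zero | inj₁ g | true | refl

  pos-last : ∀ Xs v {p} → pos Xs v ≡ suc p → ∃ λ X → At p Xs X × cc < w (X ∩⁻ v)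
  pos-last (X ∷ Xs) v eq with pos Xs v in eq′
  pos-last (X ∷ Xs) v refl | suc q with pos-last Xs v eq′
  ... | Y , a , h = Y , there a , h
  pos-last (X ∷ Xs) v eq | zero with cc <ᵇ w (X ∩⁻ v) in e
  pos-last (X ∷ Xs) v refl | zero | true = X , here , <ᵇ-elim e

  -- The set at index `pos Xs v` minus 1 contains a heavy in-neighbourhood of `v`, so by `conflict`
  -- no earlier set contains a heavy out-neighbourhood.
  pos-before : ∀ {Xs} → AllPairs _≪_ Xs → ∀ {v i X} → inU v → At i Xs X → suc i < pos Xs v →
               w (X ∩⁺ v) ≤ cc
  pos-before {Xs} pairs {v} {i} {X} v∈ p i< with pos Xs v in eq
  ... | suc q with pos-last Xs v eq | <-≤-connex cc (w (X ∩⁺ v))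
  ...   | _           | inj₂ h = h
  ...   | Y , a , Y>  | inj₁ h = ⊥-elim (conflict v∈ (At-AllPairs pairs p a (s≤s⁻¹ i<)) h Y>)

  Good : List (V → Bool) → Set
  Good Xs = AllPairs _≪_ Xs × All (λ X → reserve < w X) Xs

  -- Position `i` leaves only index i - 1 undecided. The sets at i - 2, i - 1 and i give way to the
  -- four sets `Ys`; those at i - 2 and i act as the middle sets for `between`. For small `i` fewer
  -- than three sets are dropped.
  refine : ∀ {Xs i} → Good Xs → fourBound reserve < w (λ v → pos Xs v ≡ᵇ i) →
           (∀ Xs′ → Good Xs′ → length Xs < length Xs′ → ⊥) → ⊥
  refine {Xs} {i} (pairs , heavy) big kont = four reserve big λ Ys len Ys⊑ Ys> Ys≪ →
    -- Any vertex of this position witnesses `i ≤ length Xs`.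
    inhab (≤-<-trans z≤n big) λ {u} u∈ →
    kont (take (i ∸ 2) Xs ++ Ys ++ drop (suc i) Xs)
      ( AllPairsₚ.++⁺ (AllPairsₚ.take⁺ (i ∸ 2) pairs)
          (AllPairsₚ.++⁺ Ys≪ (AllPairsₚ.drop⁺ (suc i) pairs)
            (All.map (λ {Y} (Y⊑ : Y ⊑ B) → All-drop (suc i) Xs (right Y⊑)) Ys⊑))
          (All-take (i ∸ 2) Xs λ j< p → Allₚ.++⁺ (All.map (λ {Y} (Y⊑ : Y ⊑ B) → left (i≤ u∈) Y⊑ j< p) Ys⊑)
            (All-drop (suc i) Xs λ i≤ q →
              At-AllPairs pairs p q (<-trans j< (≤-<-trans (m∸n≤m i 2) i≤))))
      , Allₚ.++⁺ (Allₚ.take⁺ (i ∸ 2) heavy) (Allₚ.++⁺ Ys> (Allₚ.drop⁺ (suc i) heavy)) )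
      (longer Ys len (i≤ u∈))
    where
    B : V → Bool
    B v = pos Xs v ≡ᵇ i
    pos≡ : ∀ {v} → v ∈ B → pos Xs v ≡ i
    pos≡ {v} v∈ = ≡ᵇ⇒≡ _ _ (Equivalence.from T-≡ (isin v∈))
    i≤ : ∀ {v} → v ∈ B → i ≤ length Xs
    i≤ {v} v∈ = subst (_≤ length Xs) (pos≡ v∈) (pos≤length Xs v)
    gap : ∀ i {j} → j < i ∸ 2 → suc (i ∸ 2) < i
    gap (suc (suc i)) _ = ≤-refl
    right : ∀ {Y j Q} → Y ⊑ B → suc i ≤ j → At j Xs Q → Y ≪ Q
    right Y⊑ i<j q with at Xs (<-trans i<j (At-length q))
    ... | M , m = between (At-All heavy m)
      (λ y∈ → pos-after Xs _ m (≤-reflexive (pos≡ (Y⊑ y∈))))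
      (λ q∈ → ≤-trans (earlier (At-AllPairs pairs m q i<j) q∈) c≤cc)
    left : ∀ {Y j P} → i ≤ length Xs → Y ⊑ B → j < i ∸ 2 → At j Xs P → P ≪ Y
    left i≤ Y⊑ j< p with at Xs (<-≤-trans (<-trans (n<1+n (i ∸ 2)) (gap i j<)) i≤)
    ... | M , m = between (At-All heavy m)
      (λ p∈ → ≤-trans (later (At-AllPairs pairs p m j<) p∈) c≤cc)
      (λ y∈ → pos-before pairs (univ y∈) m (≤-trans (gap i j<) (≤-reflexive (sym (pos≡ (Y⊑ y∈))))))
    longer : ∀ Ys → length Ys ≡ 4 → i ≤ length Xs →
             length Xs < length (take (i ∸ 2) Xs ++ Ys ++ drop (suc i) Xs)
    longer Ys len i≤ = begin-strict
      length Xs                                        ≤⟨ m≤n+m∸n (length Xs) (suc i) ⟩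
      suc i + (length Xs ∸ suc i)                      <⟨ +-monoˡ-< _ (s≤s (s≤s (m≤n+m∸n i 2))) ⟩
      4 + (i ∸ 2) + (length Xs ∸ suc i)                ≡⟨ cong (_+ (length Xs ∸ suc i)) (+-comm 4 (i ∸ 2)) ⟩
      i ∸ 2 + 4 + (length Xs ∸ suc i)                  ≡⟨ +-assoc (i ∸ 2) 4 _ ⟩
      i ∸ 2 + (4 + (length Xs ∸ suc i))                ≡⟨ cong₂ _+_ (sym lenTake) (cong₂ _+_ (sym len) (sym (length-drop (suc i) Xs))) ⟩
      length (take (i ∸ 2) Xs) + (length Ys + length (drop (suc i) Xs))
                                                       ≡⟨ cong (length (take (i ∸ 2) Xs) +_) (sym (length-++ Ys)) ⟩
      length (take (i ∸ 2) Xs) + length (Ys ++ drop (suc i) Xs)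
                                                       ≡⟨ sym (length-++ (take (i ∸ 2) Xs)) ⟩
      length (take (i ∸ 2) Xs ++ Ys ++ drop (suc i) Xs) ∎
      where
      open ≤-Reasoning
      lenTake : length (take (i ∸ 2) Xs) ≡ i ∸ 2
      lenTake = trans (length-take (i ∸ 2) Xs) (m≤n⇒m⊓n≡m (≤-trans (m∸n≤m i 2) i≤))

  -- Every second member of a good list contributes a vertex outside all the others.
  representatives : ∀ Xs → Good Xs →
    (∀ vs → AllPairs _≢_ vs → length Xs ≤ suc (2 * length vs) →
       (∀ {M} → All (M ≪_) Xs → All (λ v → w (M ∩⁺ v) ≤ c) vs) → ⊥) → ⊥
  representatives []       _ kont = kont [] [] z≤n (λ _ → [])
  representatives (X ∷ []) _ kont = kont [] [] ≤-refl (λ _ → [])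
  representatives (X ∷ M ∷ Xs) ((X≪M ∷ X≪) ∷ M≪ ∷ pairs , X> ∷ M> ∷ heavy) kont =
    representatives Xs (pairs , heavy) λ vs distinct len out →
    inhab (≤-<-trans z≤n X>) λ {x} x∈ →
    kont (x ∷ vs) (All.map (fresh x∈) (out M≪) ∷ distinct)
      (≤-trans (s≤s (s≤s len)) (≤-reflexive (cong suc (sym (*-suc 2 (length vs))))))
      (λ { (M′≪X ∷ _ ∷ M′≪) → earlier M′≪X x∈ ∷ out M′≪ })
    where
    -- A repeated representative would have both a light in-neighbourhood and a light
    -- out-neighbourhood in the skipped set `M`, which is too heavy for that.
    fresh : ∀ {x v} → x ∈ X → w (M ∩⁺ v) ≤ c → x ≢ v
    fresh {x} x∈ h refl = <-irrefl refl (<-≤-trans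
      (remains (cut⁻ {l = x ∷ []} ≤-refl (h ∷ [])) rep≤reserve M>)
      (≤-trans (mono (λ v∈ → ∈-∩ (∈-∩ˡ v∈) (∧-left (∈-∩ʳ v∈)))) (later X≪M x∈)))

  module _ {Xs} (good : Good Xs) where

    Increasing : V → V → Set
    Increasing u v = pos Xs u < pos Xs v × v ⟶ u

    -- Right to left along the clique; the block between u and v′ lies in the member of Xs at
    -- index pos Xs u.
    build : ∀ m u vs left → m + m ≤ length vs → length left + m ≤ k →
      inU u → All inU vs → AllPairs Increasing (u ∷ vs) →
      All (λ x → All (Increasing x) (u ∷ vs)) left →
      (∀ is → Alternating CopyA m is → AllPairs _◁_ (vtx u ∷ is) →
         All (λ x → All (vtx x ◁_) is) left → length (flat (vtx u ∷ is)) ≤ suc (m * suc s) →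
         All inU (flat (vtx u ∷ is)) →
         (∀ {l X} → At l Xs X → suc l < pos Xs u → All (λ r → w (X ∩⁺ r) ≤ cc) (flat (vtx u ∷ is))) →
         ⊥) → ⊥
    build zero u vs left _ _ u∈ _ _ _ kont =
      kont [] [] ([] ∷ []) (All.universal (λ _ → []) left) ≤-refl (u∈ ∷ [])
        (λ p l< → pos-before (proj₁ good) u∈ p l< ∷ [])
    build (suc m) u [] left () _ _ _ _ _ _
    build (suc m) u (_ ∷ []) left (s≤s h) = ⊥-elim (1+n≰n (≤-trans (≤-trans (s≤s z≤n) (≤-reflexive (sym (+-suc m m)))) h))
    build (suc m) u (v ∷ v′ ∷ vs) left len lenL u∈ (v∈ ∷ v′∈ ∷ vs∈)
      ((uv ∷ uv′ ∷ uvs) ∷ (vv′ ∷ _) ∷ pairs) lefts kont =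
      build m v′ vs (u ∷ left)
        (s≤s⁻¹ (≤-trans (≤-reflexive (sym (+-suc m m))) (s≤s⁻¹ len)))
        (≤-trans (≤-reflexive (sym (+-suc (length left) m))) lenL)
        v′∈ vs∈ pairs
        ((uv′ ∷ uvs) ∷ All.map (λ { (_ ∷ _ ∷ hs) → hs }) lefts)
        λ is alt ord left◁ short ins sparse →
        heavyA (remains (cut⁻ {X ⊓⁺ (u ∷ left)} (≤-trans short (s≤s (*-monoˡ-≤ (suc s) m≤k)))
                          (All.map (≤-trans (w-∩-mono ∈-∩ˡ)) (sparse atX gap)))
                        ≤-refl
                        (remains (cut⁺ {X} lenUL (afterX ≤-refl ∷
                             All.map (λ hs → afterX (<⇒≤ (proj₁ (All.head hs)))) lefts))
                           comb≤reserve (At-All (proj₂ good) atX)))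
          λ Z cZ Z⊆ →
          let ZX : All (_∈ X) Z
              ZX = All.map (∈-∩ˡ ∘ ∈-∩ˡ) Z⊆
              toZ : (u ∷ left) ⇒ Z
              toZ = ⊓⁺-arcs (All.map ∈-∩ˡ Z⊆)
              fromZ : Z ⇒ flat (vtx v′ ∷ is)
              fromZ = ⊓⁻-arcs Z⊆
          in kont (blk Z ∷ vtx v′ ∷ is) (cons cZ alt)
               ((all-intro (All.head toZ) ∷ proj₂ uv′ ∷ All.head left◁) ∷ ⇒-flat (vtx v′ ∷ is) fromZ ∷ ord)
               (All.zipWith (λ (xZ , hs , x◁) → all-intro xZ ∷ proj₂ (All.head (All.tail (All.tail hs))) ∷ x◁)
                  (All.tail toZ , All.zip (lefts , All.tail left◁)))
               (≤-trans (≤-reflexive (cong suc (length-++ Z)))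
                  (≤-trans (s≤s (+-mono-≤ (lenA cZ) short)) (≤-reflexive (cong suc (+-suc s (m * suc s))))))
               (u∈ ∷ Allₚ.++⁺ (All.map univ ZX) ins)
               (λ p l< → pos-before (proj₁ good) u∈ p l< ∷ Allₚ.++⁺
                  (All.map (λ z∈ → ≤-trans (earlier (At-AllPairs (proj₁ good) p atX (<⇒≤ l<)) z∈) c≤cc) ZX)
                  (sparse p (<-trans l< (proj₁ uv′))))
      where
      -- The skipped clique vertex `v` makes the positions differ by at least two, so the set at
      -- index `pos Xs u` mostly points to `v′` while `u` and `left` mostly point to it.
      gap : suc (pos Xs u) < pos Xs v′
      gap = ≤-<-trans (proj₁ uv) (proj₁ vv′)
      found = at Xs (<-≤-trans (<-trans (n<1+n _) gap) (pos≤length Xs v′))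
      X : V → Bool
      X = proj₁ found
      atX : At (pos Xs u) Xs X
      atX = proj₂ found
      afterX : ∀ {x} → pos Xs x ≤ pos Xs u → w (X ∩⁻ x) ≤ cc
      afterX {x} = pos-after Xs x atX
      m≤k : m ≤ k
      m≤k = ≤-trans (n≤1+n m) (≤-trans (m≤n+m (suc m) (length left)) lenL)
      lenUL : suc (length left) ≤ k
      lenUL = ≤-trans (≤-trans (s≤s (m≤m+n (length left) m)) (≤-reflexive (sym (+-suc (length left) m)))) lenL

    increasing-short : ∀ vs → All inU vs → AllPairs Increasing vs → length vs ≤ k + k
    increasing-short vs vs∈ pairs with <-≤-connex (k + k) (length vs)
    ... | inj₂ h = h
    increasing-short (u ∷ vs) (u∈ ∷ vs∈) pairs | inj₁ (s≤s h) =
      ⊥-elim (build k u vs [] h ≤-refl u∈ vs∈ pairs [] λ is alt ord _ _ ins _ → noA alt ord ins)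

  module _ (layered : Layered) (big : mainBound < w full) where

    -- Fuel replaces the choice of a longest sequence: every refinement lengthens `Xs`, and
    -- `representatives` allows at most 2N + 1 members. Once no position is heavy, `layered`
    -- contradicts `big`.
    iterate : ∀ fuel Xs → Good Xs → suc (suc (2 * N)) ≤ fuel + length Xs → ⊥
    iterate zero Xs good enough = representatives Xs good λ vs distinct len _ →
      <-irrefl refl (<-≤-trans enough (≤-trans len (s≤s (*-monoʳ-≤ 2 (finite vs distinct)))))
    iterate (suc fuel) Xs good enough = <-irrefl mainBound≡ (<-≤-trans big
      (layered (pos Xs) (length Xs) (pos≤length Xs) light (increasing-short good)))
      where
      light : ∀ i → w (λ v → pos Xs v ≡ᵇ i) ≤ fourBound reserve
      light i with <-≤-connex (fourBound reserve) (w (λ v → pos Xs v ≡ᵇ i))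
      ... | inj₂ h = h
      ... | inj₁ h = ⊥-elim (refine good h λ Xs′ good′ longer → iterate fuel Xs′ good′
              (≤-trans enough (≤-trans (≤-reflexive (sym (+-suc fuel _))) (+-monoʳ-≤ fuel longer))))

    impossible : ⊥
    impossible = iterate (suc (suc (2 * N))) [] ([] , []) (≤-reflexive (sym (+-identityʳ _)))

-- Clique number as a weight

lookup-distinct : ∀ {A : Set} {xs : List A} → AllPairs _≢_ xs → Injective _≡_ _≡_ (lookup xs)
lookup-distinct {xs = x ∷ xs} (h ∷ hs) {zero}  {zero}  eq = refl
lookup-distinct {xs = x ∷ xs} (h ∷ hs) {zero}  {suc j} eq = ⊥-elim (All.lookup h (∈-lookup {xs = xs} j) eq)
lookup-distinct {xs = x ∷ xs} (h ∷ hs) {suc i} {zero}  eq = ⊥-elim (All.lookup h (∈-lookup {xs = xs} i) (sym eq))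
lookup-distinct {xs = x ∷ xs} (h ∷ hs) {suc i} {suc j} eq = cong suc (lookup-distinct hs eq)

distinct-length : ∀ {N} (vs : List (Fin N)) → AllPairs _≢_ vs → length vs ≤ N
distinct-length vs distinct = injective⇒≤ (lookup-distinct distinct)

AllPairs-reverse : ∀ {A : Set} {R : A → A → Set} {xs} → AllPairs R xs → AllPairs (flip R) (reverse xs)
AllPairs-reverse []                  = []
AllPairs-reverse {R = R} {x ∷ xs} (h ∷ hs) = subst (AllPairs (flip R)) (sym (unfold-reverse x xs))
  (AllPairsₚ.++⁺ (AllPairs-reverse hs) ([] ∷ []) (All.map (_∷ []) (All-reverse h)))
  where
  All-reverse : ∀ {P : _ → Set} {ys} → All P ys → All P (reverse ys)
  All-reverse h = All.tabulate λ y∈ → All.lookup h (Anyₚ.reverse⁻ y∈)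

AllPairs-++⁻ : ∀ {A : Set} {R : A → A → Set} xs {ys} → AllPairs R (xs ++ ys) →
               AllPairs R xs × AllPairs R ys × All (λ x → All (R x) ys) xs
AllPairs-++⁻ []       h        = [] , h , []
AllPairs-++⁻ (x ∷ xs) (h ∷ hs) with AllPairs-++⁻ xs hs
... | p , q , r = Allₚ.++⁻ˡ xs h ∷ p , q , Allₚ.++⁻ʳ xs h ∷ r

⊆-++⁻ : ∀ {A : Set} xs {zs ys : List A} → ys ⊆ xs ++ zs →
        ∃ λ ys₁ → ∃ λ ys₂ → ys ≡ ys₁ ++ ys₂ × ys₁ ⊆ xs × ys₂ ⊆ zs
⊆-++⁻ []       {ys = ys} h = [] , ys , refl , [] , h
⊆-++⁻ (x ∷ xs) (.x ∷ʳ h) with ⊆-++⁻ xs h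
... | ys₁ , ys₂ , eq , p , q = ys₁ , ys₂ , eq , x ∷ʳ p , q
⊆-++⁻ (x ∷ xs) (refl ∷ h) with ⊆-++⁻ xs h
... | ys₁ , ys₂ , refl , p , q = x ∷ ys₁ , ys₂ , refl , refl ∷ p , q

module Cliques {V : Set} (arc : V → V → Bool) where

  -- `L` is read as an ordering and `ys` as a clique of its backedge graph. Repetitions in `L` are
  -- tolerated, so that `Le-join` can just concatenate.
  Narrow : ℕ → List V → Set
  Narrow k L = ∀ {ys} → ys ⊆ L → AllPairs (λ u v → arc v u ≡ true) ys → length ys ≤ k

  -- The induced subtournament on S has clique number at most k.
  Le : ℕ → (V → Bool) → Set
  Le k S = ∃ λ L → (∀ {v} → S v ≡ true → v ∈ₗ L) × All (λ v → S v ≡ true) L × Narrow k L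

  Le-mono : ∀ {k S S′} → (∀ {v} → S v ≡ true → S′ v ≡ true) → Le k S′ → Le k S
  Le-mono {S = S} sub (L , cover , inside , narrow) =
    filter S? L , (λ v∈ → ∈-filter⁺ S? (cover (sub v∈)) v∈) , Allₚ.all-filter S? L ,
    λ ys⊆ → narrow (⊆-trans ys⊆ (filter-⊆ S? L))
    where S? = λ v → S v ≟ᵇ true

  Le-weaken : ∀ {k k′ S} → k ≤ k′ → Le k S → Le k′ S
  Le-weaken k≤ (L , cover , inside , narrow) = L , cover , inside , λ ys⊆ back → ≤-trans (narrow ys⊆ back) k≤

  Le-join : ∀ {k₁ k₂ S₁ S₂ S} → (∀ {v} → S v ≡ true → S₁ v ≡ true ⊎ S₂ v ≡ true) →
            (∀ {v} → S₁ v ≡ true → S v ≡ true) → (∀ {v} → S₂ v ≡ true → S v ≡ true) →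
            Le k₁ S₁ → Le k₂ S₂ → Le (k₁ + k₂) S
  Le-join {k₁} {k₂} {S = S} split in₁ in₂ (L₁ , cover₁ , inside₁ , narrow₁) (L₂ , cover₂ , inside₂ , narrow₂) =
    L₁ ++ L₂ , cover , Allₚ.++⁺ (All.map in₁ inside₁) (All.map in₂ inside₂) , narrow
    where
    cover : ∀ {v} → S v ≡ true → v ∈ₗ L₁ ++ L₂
    cover v∈ with split v∈
    ... | inj₁ h = ∈-++⁺ˡ (cover₁ h)
    ... | inj₂ h = ∈-++⁺ʳ L₁ (cover₂ h)
    narrow : Narrow (k₁ + k₂) (L₁ ++ L₂)
    narrow ys⊆ back with ⊆-++⁻ L₁ ys⊆
    ... | ys₁ , ys₂ , refl , p , q with AllPairs-++⁻ ys₁ back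
    ... | b₁ , b₂ , _ = ≤-trans (≤-reflexive (length-++ ys₁)) (+-mono-≤ (narrow₁ p b₁) (narrow₂ q b₂))

  -- The first vertex of an ordering dominates all the others except its backward neighbours, and
  -- these have a smaller clique number.
  dominate : (∀ u v → u ≡ v ⊎ arc u v ≡ true ⊎ arc v u ≡ true) → ∀ k L → Narrow k L →
             ∃ λ Y → All (_∈ₗ L) Y × length Y ≤ k ×
                     (∀ {u} → u ∈ₗ L → Any (λ y → y ≡ u ⊎ arc y u ≡ true) Y)
  dominate tri k       []      narrow = [] , [] , z≤n , λ ()
  dominate tri zero    (x ∷ L) narrow = ⊥-elim (1+n≰n (narrow (refl ∷ none L) ([] ∷ [])))
    where
    none : ∀ L → [] ⊆ L
    none []      = []
    none (y ∷ L) = y ∷ʳ none L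
  dominate tri (suc k) (x ∷ L) narrow =
    let Y , inside , short , doms = dominate tri k (filter B? L) narrow′
    in x ∷ Y ,
       here refl ∷ All.map (λ y∈ → there (Any-filter y∈)) inside ,
       s≤s short ,
       λ { (here refl) → here (inj₁ refl) ; (there u∈) → step Y doms u∈ }
    where
    B? = λ u → arc u x ≟ᵇ true
    Any-filter : ∀ {y} → y ∈ₗ filter B? L → y ∈ₗ L
    Any-filter y∈ = proj₁ (∈-filter⁻ B? {xs = L} y∈)
    narrow′ : Narrow k (filter B? L)
    narrow′ ys⊆ back = s≤s⁻¹ (narrow (refl ∷ ⊆-trans ys⊆ (filter-⊆ B? L))
      (All-resp-⊆ ys⊆ (Allₚ.all-filter B? L) ∷ back))
    step : ∀ Y → (∀ {u} → u ∈ₗ filter B? L → Any (λ y → y ≡ u ⊎ arc y u ≡ true) Y) →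
           ∀ {u} → u ∈ₗ L → Any (λ y → y ≡ u ⊎ arc y u ≡ true) (x ∷ Y)
    step Y doms {u} u∈ with tri x u
    ... | inj₁ eq        = here (inj₁ eq)
    ... | inj₂ (inj₁ xu) = here (inj₂ xu)
    ... | inj₂ (inj₂ ux) = there (doms (∈-filter⁺ B? u∈ ux))

  narrow-flip : ∀ {k L} → Narrow k L →
                ∀ {ys} → ys ⊆ reverse L → AllPairs (λ u v → arc u v ≡ true) ys → length ys ≤ k
  narrow-flip {L = L} narrow {ys} ys⊆ fwd = ≤-trans (≤-reflexive (sym (length-reverse ys)))
    (narrow (subst (reverse ys ⊆_) (reverse-involutive L) (reverse⁺ ys⊆)) (AllPairs-reverse fwd))

  module _ (p : V → ℕ) {b : ℕ} {S : V → Bool}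
    (layer : ∀ i → Le b (S ∩ (λ v → p v ≡ᵇ i))) where

    stack : ℕ → ℕ → List V
    stack i zero    = []
    stack i (suc r) = proj₁ (layer i) ++ stack (suc i) r

    p≡ : ∀ {i v} → (S ∩ (λ v → p v ≡ᵇ i)) v ≡ true → p v ≡ i
    p≡ eq = ≡ᵇ⇒≡ _ _ (Equivalence.from T-≡ (∩-right eq))

    stack-inside : ∀ i r → All (λ v → S v ≡ true) (stack i r)
    stack-inside i zero    = []
    stack-inside i (suc r) = Allₚ.++⁺ (All.map ∩-left (proj₁ (proj₂ (proj₂ (layer i))))) (stack-inside (suc i) r)

    stack-cover : ∀ i r {v} → S v ≡ true → i ≤ p v → p v < r + i → v ∈ₗ stack i r
    stack-cover i zero    v∈ i≤ <i = ⊥-elim (<-irrefl refl (≤-<-trans i≤ <i))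
    stack-cover i (suc r) {v} v∈ i≤ <i with m≤n⇒m<n∨m≡n i≤
    ... | inj₁ i<   = ∈-++⁺ʳ (proj₁ (layer i))
                        (stack-cover (suc i) r v∈ i< (<-≤-trans <i (≤-reflexive (sym (+-suc r i)))))
    ... | inj₂ refl = ∈-++⁺ˡ (proj₁ (proj₂ (layer i)) (∩-intro v∈ (Equivalence.to T-≡ (≡⇒≡ᵇ (p v) (p v) refl))))

    -- Keep the first vertex of `ys` in each layer that it meets; each kept vertex stands for at
    -- most `b` vertices.
    transversal : ∀ i r {ys} → ys ⊆ stack i r → AllPairs (λ u v → arc v u ≡ true) ys →
      ∃ λ zs → AllPairs (λ u v → p u < p v × arc v u ≡ true) zs × All (λ v → i ≤ p v) zs ×
               (∀ {Q : V → Set} → All Q ys → All Q zs) × length ys ≤ length zs * b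
    transversal i zero    []  back = [] , [] , [] , id , z≤n
    transversal i (suc r) ys⊆ back with ⊆-++⁻ (proj₁ (layer i)) ys⊆
    ... | ys₁ , ys₂ , refl , q₁ , q₂ with AllPairs-++⁻ ys₁ back
    ...   | b₁ , b₂ , cross with transversal (suc i) r q₂ b₂
    transversal i (suc r) ys⊆ back | [] , ys₂ , refl , q₁ , q₂ | b₁ , b₂ , cross | zs , inc , above , from , short =
      zs , inc , All.map <⇒≤ above , from , short
    transversal i (suc r) ys⊆ back | y ∷ ys₁ , ys₂ , refl , q₁ , q₂ | b₁ , b₂ , cy ∷ cross | zs , inc , above , from , short =
      y ∷ zs ,
      All.zip (All.map (≤-trans (s≤s (≤-reflexive py))) above , from cy) ∷ inc ,
      ≤-reflexive (sym py) ∷ All.map <⇒≤ above ,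
      (λ { (h ∷ hs) → h ∷ from (Allₚ.++⁻ʳ ys₁ hs) }) ,
      ≤-trans (≤-reflexive (length-++ (y ∷ ys₁))) (+-mono-≤ (proj₂ (proj₂ (proj₂ (layer i))) q₁ b₁) short)
      where
      py : p y ≡ i
      py = p≡ (All.head (All-resp-⊆ q₁ (proj₁ (proj₂ (proj₂ (layer i))))))

    stack-Le : ∀ R {a} → (∀ v → p v ≤ R) →
      (∀ vs → All (λ v → S v ≡ true) vs → AllPairs (λ u v → p u < p v × arc v u ≡ true) vs → length vs ≤ a) →
      Le (a * b) S
    stack-Le R {a} p≤ short = stack 0 (suc R) ,
      (λ v∈ → stack-cover 0 (suc R) v∈ z≤n (s≤s (≤-trans (p≤ _) (≤-reflexive (sym (+-identityʳ R)))))) ,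
      stack-inside 0 (suc R) ,
      λ ys⊆ back → let zs , inc , _ , from , len = transversal 0 (suc R) ys⊆ back
                   in ≤-trans len (*-monoˡ-≤ b (short zs (from (All-resp-⊆ ys⊆ (stack-inside 0 (suc R)))) inc))

module Concrete {N : ℕ} (arc : Fin N → Fin N → Bool)
  (tri : ∀ u v → u ≡ v ⊎ arc u v ≡ true ⊎ arc v u ≡ true)
  (ω : (Fin N → Bool) → ℕ)
  (ω-Le : ∀ S → Cliques.Le arc (ω S) S) (ω-min : ∀ {k S} → Cliques.Le arc k S → ω S ≤ k) where

  open Cliques arc

  V : Set
  V = Fin N

  module _ (U : V → Bool) where

    open Sets U

    w : (V → Bool) → ℕ
    w X = ω (U ∩ X)

    enter : ∀ {X v} → (U ∩ X) v ≡ true → v ∈ X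
    enter eq = mem (∩-left eq) (∩-right eq)

    leave : ∀ {X v} → v ∈ X → (U ∩ X) v ≡ true
    leave (mem p q) = ∩-intro p q

    mono : ∀ {X Y} → X ⊑ Y → w X ≤ w Y
    mono X⊑Y = ω-min (Le-mono (λ h → leave (X⊑Y (enter h))) (ω-Le _))

    sub : ∀ {X Y Z} → (∀ {v} → v ∈ X → v ∈ Y ⊎ v ∈ Z) → w X ≤ w Y + w Z
    sub {X} {Y} {Z} split = ≤-trans
      (ω-min (Le-join split′ ∩-left ∩-left (ω-Le (U ∩ X ∩ Y)) (ω-Le (U ∩ X ∩ Z))))
      (+-mono-≤ (ω-min (Le-mono to-Y (ω-Le _))) (ω-min (Le-mono to-Y (ω-Le _))))
      where
      split′ : ∀ {v} → (U ∩ X) v ≡ true → (U ∩ X ∩ Y) v ≡ true ⊎ (U ∩ X ∩ Z) v ≡ true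
      split′ h with split (enter h)
      ... | inj₁ y∈ = inj₁ (∩-intro h (isin y∈))
      ... | inj₂ z∈ = inj₂ (∩-intro h (isin z∈))
      to-Y : ∀ {Y v} → (U ∩ X ∩ Y) v ≡ true → (U ∩ Y) v ≡ true
      to-Y h = ∩-intro (∩-left (∩-left h)) (∩-right h)

    sing : ∀ {X} x → (∀ {v} → v ∈ X → v ≡ x) → w X ≤ 1
    sing {X} x only = ω-min
      ( filter X? (x ∷ []) , (λ h → ∈-filter⁺ X? (here (only (enter h))) h) , Allₚ.all-filter X? (x ∷ [])
      , λ ys⊆ _ → ≤-trans (length-mono-≤ ys⊆) (length-filter X? (x ∷ [])) )
      where X? = λ v → (U ∩ X) v ≟ᵇ true

    empty : ∀ {X} → (∀ {v} → v ∈ X → ⊥) → w X ≤ 0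
    empty none = ω-min ([] , (λ h → ⊥-elim (none (enter h))) , [] , λ { [] _ → z≤n })

    dom : ∀ X → ∃ λ Y → All (_∈ X) Y × length Y ≤ w X
              × (∀ {u} → u ∈ X → Any (λ y → y ≡ u ⊎ arc y u ≡ true) Y)
    dom X with ω-Le (U ∩ X)
    ... | L , cover , inside , narrow with dominate tri _ L narrow
    ...   | Y , Y⊆ , short , doms =
      Y , All.map (λ y∈ → enter (All.lookup inside y∈)) Y⊆ , short , λ u∈ → doms (cover (leave u∈))

    prefix : (V → Bool) → ℕ → V → Bool
    prefix X i = X ∩ (λ v → toℕ v <ᵇ i)

    -- Adding the vertices of `X` one by one raises the weight by at most 1 each time; stop at the
    -- first prefix above `M`.
    trim : ∀ {M X} → M < w X → ∃ λ Y → Y ⊑ X × M < w Y × w Y ≤ suc M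
    trim {M} {X} X> with search N
      where
      Trimmed : Set
      Trimmed = ∃ λ Y → Y ⊑ X × M < w Y × w Y ≤ suc M
      prefix-⊑ : ∀ i → prefix X i ⊑ X
      prefix-⊑ i (mem p q) = mem p (∩-left q)
      next : ∀ {i} → w (prefix X i) ≤ M → w (prefix X (suc i)) ≤ suc M
      next {i} h = ≤-trans (sub split) (≤-trans (+-mono-≤ h (last i)) (≤-reflexive (+-comm M 1)))
        where
        split : ∀ {v} → v ∈ prefix X (suc i) → v ∈ prefix X i ⊎ v ∈ (λ v → toℕ v ≡ᵇ i)
        split {v} (mem p q) with m≤n⇒m<n∨m≡n (s≤s⁻¹ (<ᵇ-elim (∩-right q)))
        ... | inj₁ v< = inj₁ (mem p (∩-intro (∩-left q) (<ᵇ-intro v<)))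
        ... | inj₂ v≡ = inj₂ (mem p (Equivalence.to T-≡ (≡⇒≡ᵇ (toℕ v) i v≡)))
        last : ∀ i → w (λ v → toℕ v ≡ᵇ i) ≤ 1
        -- `sing` needs a vertex, which may not exist; hence the detour through `empty`.
        last i with <-≤-connex 1 (w (λ v → toℕ v ≡ᵇ i))
        ... | inj₂ h = h
        ... | inj₁ h = ⊥-elim (<-irrefl refl (<-≤-trans (<-trans (n<1+n 0) h) (empty λ {v} v∈ →
          <-irrefl refl (<-≤-trans h (sing v λ {u} u∈ → toℕ-injective (trans (eq u∈) (sym (eq v∈))))))))
          where
          eq : ∀ {v} → v ∈ (λ v → toℕ v ≡ᵇ i) → toℕ v ≡ i
          eq v∈ = ≡ᵇ⇒≡ _ _ (Equivalence.from T-≡ (isin v∈))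
      search : ∀ i → w (prefix X i) ≤ M ⊎ Trimmed
      search zero    = inj₁ (≤-trans (empty λ v∈ → not-false {false} refl (∩-right (isin v∈))) z≤n)
      search (suc i) with search i
      ... | inj₂ t = inj₂ t
      ... | inj₁ h with <-≤-connex M (w (prefix X (suc i)))
      ...   | inj₂ g = inj₁ g
      ...   | inj₁ g = inj₂ (prefix X (suc i) , prefix-⊑ (suc i) , g , next h)
    ... | inj₂ t = t
    ... | inj₁ h = ⊥-elim (<-irrefl refl (<-≤-trans X> (≤-trans
            (mono λ {v} v∈ → mem (univ v∈) (∩-intro (isin v∈) (<ᵇ-intro (toℕ<n v)))) h)))

    weight : Weight arc U
    weight = record
      { w = w ; mono = mono ; sub = sub ; sing = sing
      ; inhab = λ X> none → <-irrefl refl (<-≤-trans X> (empty none))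
      ; dom = dom ; trim = trim }

    -- Reversing both the ordering and the arcs preserves backward cliques, so `dominate` applies.
    absorbing : Absorbing weight
    absorbing X with ω-Le (U ∩ X)
    ... | L , cover , inside , narrow
      with Cliques.dominate (flip arc) (λ u v → swap-tri (tri u v)) _ (reverse L) (narrow-flip narrow)
    ...   | Y , Y⊆ , short , doms =
      Y , All.map (λ y∈ → enter (All.lookup inside (Anyₚ.reverse⁻ y∈))) Y⊆ , short ,
      λ u∈ → doms (Anyₚ.reverse⁺ (cover (leave u∈)))

    layered : ∀ (p : V → ℕ) R {a b} → (∀ v → p v ≤ R) → (∀ i → w (λ v → p v ≡ᵇ i) ≤ b) →
              (∀ vs → All (λ v → U v ≡ true) vs →
                 AllPairs (λ u v → p u < p v × arc v u ≡ true) vs → length vs ≤ a) →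
              w (λ _ → true) ≤ a * b
    layered p R p≤ layers short = ω-min (Le-mono ∩-left (stack-Le p {S = U}
      (λ i → Le-weaken (layers i) (ω-Le _)) R p≤ short))

-- Copies of A and D

is-false : ∀ {b} → ¬ (b ≡ true) → b ≡ false
is-false {true}  h = ⊥-elim (h refl)
is-false {false} h = refl

<ᵇ-false : ∀ {m n} → ¬ (m < n) → (m <ᵇ n) ≡ false
<ᵇ-false h = is-false λ eq → h (<ᵇ-elim eq)

≤ᵇ-false : ∀ {m n} → ¬ (m ≤ n) → (m ≤ᵇ n) ≡ false
≤ᵇ-false h = is-false λ eq → h (≤ᵇ-elim eq)

≡ᵇ-true : ∀ {m n} → m ≡ n → (m ≡ᵇ n) ≡ true
≡ᵇ-true eq = Equivalence.to T-≡ (≡⇒≡ᵇ _ _ eq)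

≡ᵇ-false : ∀ {m n} → m ≢ n → (m ≡ᵇ n) ≡ false
≡ᵇ-false h = is-false λ eq → h (≡ᵇ⇒≡ _ _ (Equivalence.from T-≡ eq))

Total : {A : Set} → (A → A → Bool) → Set
Total f = ∀ x y → x ≡ y ⊎ f x y ≡ true ⊎ f y x ≡ true

darc-total : ∀ {k} → Total (darc {k})
darc-total d-one       d-one       = inj₁ refl
darc-total (d-left x)  (d-left y)  with darc-total x y
... | inj₁ eq = inj₁ (cong d-left eq)
... | inj₂ h  = inj₂ h
darc-total (d-left x)  (d-right y) = inj₂ (inj₁ refl)
darc-total (d-left x)  d-w         = inj₂ (inj₂ refl)
darc-total (d-right x) (d-left y)  = inj₂ (inj₂ refl)
darc-total (d-right x) (d-right y) with darc-total x y
... | inj₁ eq = inj₁ (cong d-right eq)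
... | inj₂ h  = inj₂ h
darc-total (d-right x) d-w         = inj₂ (inj₁ refl)
darc-total d-w         (d-left y)  = inj₂ (inj₁ refl)
darc-total d-w         (d-right y) = inj₂ (inj₂ refl)
darc-total d-w         d-w         = inj₁ refl

aarc-same : ∀ {k} {i j : Fin (suc k)} (x y : AV k) → toℕ i ≡ toℕ j → aarc (a-t i x) (a-t j y) ≡ aarc x y
aarc-same {i = i} {j} x y eq rewrite ≡ᵇ-true eq = refl

aarc-diff : ∀ {k} {i j : Fin (suc k)} (x y : AV k) → toℕ i ≢ toℕ j →
            aarc (a-t i x) (a-t j y) ≡ (toℕ i <ᵇ toℕ j)
aarc-diff {i = i} {j} x y neq rewrite ≡ᵇ-false neq = refl

aarc-total : ∀ {k} → Total (aarc {k})
aarc-total a-one a-one = inj₁ refl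
aarc-total (a-t i x) (a-t j y) with <-cmp (toℕ i) (toℕ j)
... | tri< i<j i≢j _ = inj₂ (inj₁ (trans (aarc-diff x y i≢j) (<ᵇ-intro i<j)))
... | tri> _ i≢j j<i = inj₂ (inj₂ (trans (aarc-diff y x (i≢j ∘ sym)) (<ᵇ-intro j<i)))
... | tri≈ _ i≡j _ with aarc-total x y
...   | inj₁ refl     = inj₁ (cong (λ i → a-t i x) (toℕ-injective i≡j))
...   | inj₂ (inj₁ h) = inj₂ (inj₁ (trans (aarc-same x y i≡j) h))
...   | inj₂ (inj₂ h) = inj₂ (inj₂ (trans (aarc-same y x (sym i≡j)) h))
aarc-total (a-v i) (a-v j) with <-cmp (toℕ i) (toℕ j)
... | tri< i<j _ _ = inj₂ (inj₂ (<ᵇ-intro i<j))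
... | tri≈ _ i≡j _ = inj₁ (cong a-v (toℕ-injective i≡j))
... | tri> _ _ j<i = inj₂ (inj₁ (<ᵇ-intro j<i))
aarc-total (a-v i) (a-t j y) with <-≤-connex (toℕ j) (toℕ i)
... | inj₁ j<i = inj₂ (inj₂ (<ᵇ-intro j<i))
... | inj₂ i≤j = inj₂ (inj₁ (≤ᵇ-intro i≤j))
aarc-total (a-t j y) (a-v i) with <-≤-connex (toℕ j) (toℕ i)
... | inj₁ j<i = inj₂ (inj₁ (<ᵇ-intro j<i))
... | inj₂ i≤j = inj₂ (inj₂ (≤ᵇ-intro i≤j))

module Embeddings {V : Set} (arc : V → V → Bool)
  (loopless : ∀ v → arc v v ≡ false) (asym : ∀ {u v} → arc u v ≡ true → arc v u ≡ true → ⊥) where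

  open Pattern arc

  Copy : (H : Set) → (H → H → Bool) → List V → Set
  Copy H harc l = Σ (H → V) λ φ → (∀ x → φ x ∈ₗ l) × (∀ x y → arc (φ x) (φ y) ≡ harc x y)

  -- Distinct vertices of `H` are joined by an arc, so a common image would carry a loop.
  copy-injective : ∀ {H harc l} → Total harc → (C : Copy H harc l) → Injective _≡_ _≡_ (proj₁ C)
  copy-injective {harc = harc} total (φ , _ , hom) {x} {y} eq with total x y
  ... | inj₁ h        = h
  ... | inj₂ (inj₁ h) = ⊥-elim (not-false {false} refl (trans (sym (loopless (φ x))) (trans (cong (arc (φ x)) eq) (trans (hom x y) h))))
  ... | inj₂ (inj₂ h) = ⊥-elim (not-false {false} refl (trans (sym (loopless (φ y))) (trans (cong (arc (φ y)) (sym eq)) (trans (hom y x) h))))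

  no-arc : ∀ {u v} → v ⟶ u → arc u v ≡ false
  no-arc h = is-false (asym h)

  copy-D : ∀ {j l} → IsD j l → Copy (DV j) darc l
  copy-D (point v) = (λ _ → v) , (λ _ → here refl) , λ { d-one d-one → loopless v }
  copy-D (node {j} {A} {B} v dA dB vA AB Bv) with copy-D dA | copy-D dB
  ... | f , f∈ , fhom | g , g∈ , ghom = φ , φ∈ , hom
    where
    φ : DV (suc j) → V
    φ (d-left x)  = f x
    φ (d-right x) = g x
    φ d-w         = v
    φ∈ : ∀ x → φ x ∈ₗ v ∷ A ++ B
    φ∈ (d-left x)  = there (∈-++⁺ˡ (f∈ x))
    φ∈ (d-right x) = there (∈-++⁺ʳ A (g∈ x))
    φ∈ d-w         = here refl
    fg : ∀ x y → f x ⟶ g y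
    fg x y = All.lookup (All.lookup AB (f∈ x)) (g∈ y)
    hom : ∀ x y → arc (φ x) (φ y) ≡ darc x y
    hom (d-left x)  (d-left y)  = fhom x y
    hom (d-left x)  (d-right y) = fg x y
    hom (d-left x)  d-w         = no-arc (All.lookup vA (f∈ x))
    hom (d-right x) (d-left y)  = no-arc (fg y x)
    hom (d-right x) (d-right y) = ghom x y
    hom (d-right x) d-w         = All.lookup Bv (g∈ x)
    hom d-w         (d-left y)  = All.lookup vA (f∈ y)
    hom d-w         (d-right y) = no-arc (All.lookup Bv (g∈ y))
    hom d-w         d-w         = loopless v

  module _ {P : List V → Set} where

    tooth : ∀ {m is} → V → Alternating P m is → Fin (suc m) → V
    tooth u alt                  zero    = u
    tooth u (cons {v = v} _ alt) (suc i) = tooth v alt i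

    block : ∀ {m is} → Alternating P m is → Fin m → List V
    block (cons {Z = Z} _ alt) zero    = Z
    block (cons _ alt)         (suc i) = block alt i

    block-P : ∀ {m is} (alt : Alternating P m is) i → P (block alt i)
    block-P (cons p alt) zero    = p
    block-P (cons p alt) (suc i) = block-P alt i

    block-All : ∀ {Q : Item V → Set} {m is} (alt : Alternating P m is) → All Q is → ∀ i → Q (blk (block alt i))
    block-All (cons p alt) (q ∷ _)      zero    = q
    block-All (cons p alt) (_ ∷ _ ∷ qs) (suc i) = block-All alt qs i

    tooth-All : ∀ {Q : Item V → Set} {m is u} (alt : Alternating P m is) → All Q (vtx u ∷ is) →
                ∀ i → Q (vtx (tooth u alt i))
    tooth-All alt          (q ∷ _)      zero    = q
    tooth-All (cons p alt) (_ ∷ _ ∷ qs) (suc i) = tooth-All alt qs i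

    tooth-tooth : ∀ {m is u} (alt : Alternating P m is) → AllPairs _◁_ (vtx u ∷ is) →
                  ∀ i j → toℕ i < toℕ j → tooth u alt j ⟶ tooth u alt i
    tooth-tooth []           _              zero    zero    ()
    tooth-tooth (cons p alt) ((_ ∷ h) ∷ _)  zero    (suc j) _         = tooth-All alt h j
    tooth-tooth (cons p alt) (_ ∷ _ ∷ ord)  (suc i) (suc j) (s≤s i<j) = tooth-tooth alt ord i j i<j

    tooth-block : ∀ {m is u} (alt : Alternating P m is) → AllPairs _◁_ (vtx u ∷ is) →
                  ∀ i j → toℕ i ≤ toℕ j → All (tooth u alt i ⟶_) (block alt j)
    tooth-block alt          (h ∷ _)       zero    j       _         = all-elim _ (block-All alt h j)
    tooth-block (cons p alt) (_ ∷ _ ∷ ord) (suc i) (suc j) (s≤s i≤j) = tooth-block alt ord i j i≤j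

    block-tooth : ∀ {m is u} (alt : Alternating P m is) → AllPairs _◁_ (vtx u ∷ is) →
                  ∀ i j → toℕ j < toℕ i → All (_⟶ tooth u alt i) (block alt j)
    block-tooth (cons p alt) (_ ∷ h ∷ _)   (suc i) zero    _         = All.map All.head (tooth-All alt h i)
    block-tooth (cons p alt) (_ ∷ _ ∷ ord) (suc i) (suc j) (s≤s j<i) = block-tooth alt ord i j j<i

    block-block : ∀ {m is u} (alt : Alternating P m is) → AllPairs _◁_ (vtx u ∷ is) →
                  ∀ i j → toℕ i < toℕ j → block alt i ⇒ block alt j
    block-block (cons p alt) (_ ∷ (_ ∷ h) ∷ _) zero    (suc j) _         = block-All alt h j
    block-block (cons p alt) (_ ∷ _ ∷ ord)     (suc i) (suc j) (s≤s i<j) = block-block alt ord i j i<j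

    tooth∈ : ∀ {m is u} (alt : Alternating P m is) i → tooth u alt i ∈ₗ flat (vtx u ∷ is)
    tooth∈ alt                  zero    = here refl
    tooth∈ (cons {Z = Z} p alt) (suc i) = there (∈-++⁺ʳ Z (tooth∈ alt i))

    block∈ : ∀ {m is} (alt : Alternating P m is) i {z} → z ∈ₗ block alt i → z ∈ₗ flat is
    block∈ (cons p alt)         zero    z∈ = ∈-++⁺ˡ z∈
    block∈ (cons {Z = Z} p alt) (suc i) z∈ = ∈-++⁺ʳ Z (there (block∈ alt i z∈))

  copy-A : ∀ k {l} → IsA k l → Copy (AV k) aarc l
  copy-A zero    (v , refl) = (λ _ → v) , (λ _ → here refl) , λ { a-one a-one → loopless v }
  copy-A (suc k) (u , is , alt , ord , refl) = φ , φ∈ , hom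
    where
    inner : ∀ i → Copy (AV k) aarc (block alt i)
    inner i = copy-A k (block-P alt i)
    ψ : Fin (suc k) → AV k → V
    ψ i = proj₁ (inner i)
    ψ∈ : ∀ i x → ψ i x ∈ₗ block alt i
    ψ∈ i = proj₁ (proj₂ (inner i))
    φ : AV (suc k) → V
    φ (a-t i x) = ψ i x
    φ (a-v i)   = tooth u alt i
    φ∈ : ∀ x → φ x ∈ₗ flat (vtx u ∷ is)
    φ∈ (a-t i x) = there (block∈ alt i (ψ∈ i x))
    φ∈ (a-v i)   = tooth∈ alt i
    ψψ : ∀ i j x y → toℕ i < toℕ j → ψ i x ⟶ ψ j y
    ψψ i j x y i<j = All.lookup (All.lookup (block-block alt ord i j i<j) (ψ∈ i x)) (ψ∈ j y)
    hom : ∀ x y → arc (φ x) (φ y) ≡ aarc x y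
    hom (a-t i x) (a-t j y) with <-cmp (toℕ i) (toℕ j)
    ... | tri< i<j i≢j _ = trans (ψψ i j x y i<j) (sym (trans (aarc-diff x y i≢j) (<ᵇ-intro i<j)))
    ... | tri> i≮j i≢j j<i = trans (no-arc (ψψ j i y x j<i)) (sym (trans (aarc-diff x y i≢j) (<ᵇ-false i≮j)))
    ... | tri≈ _ i≡j _ with toℕ-injective i≡j
    ...   | refl = trans (proj₂ (proj₂ (inner i)) x y) (sym (aarc-same {i = i} x y refl))
    hom (a-v i) (a-v j) with <-cmp (toℕ j) (toℕ i)
    ... | tri< j<i _ _ = trans (tooth-tooth alt ord j i j<i) (sym (<ᵇ-intro j<i))
    ... | tri> j≮i _ i<j = trans (no-arc (tooth-tooth alt ord i j i<j)) (sym (<ᵇ-false j≮i))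
    ... | tri≈ j≮i j≡i _ = trans (trans (cong (λ j → arc (tooth u alt i) (tooth u alt j)) (toℕ-injective j≡i))
                                        (loopless (tooth u alt i))) (sym (<ᵇ-false j≮i))
    hom (a-v i) (a-t j y) with <-≤-connex (toℕ j) (toℕ i)
    ... | inj₁ j<i = trans (no-arc (All.lookup (block-tooth alt ord i j j<i) (ψ∈ j y)))
                           (sym (≤ᵇ-false (<⇒≱ j<i)))
    ... | inj₂ i≤j = trans (All.lookup (tooth-block alt ord i j i≤j) (ψ∈ j y)) (sym (≤ᵇ-intro i≤j))
    hom (a-t j y) (a-v i) with <-≤-connex (toℕ j) (toℕ i)
    ... | inj₁ j<i = trans (All.lookup (block-tooth alt ord i j j<i) (ψ∈ j y)) (sym (<ᵇ-intro j<i))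
    ... | inj₂ i≤j = trans (no-arc (All.lookup (tooth-block alt ord i j i≤j) (ψ∈ j y)))
                           (sym (<ᵇ-false (≤⇒≯ i≤j)))

-- The recursive bound and the induction on both indices

sizeD sizeA : ℕ → ℕ
sizeD zero    = 1
sizeD (suc j) = suc (sizeD j + sizeD j)
sizeA zero    = 1
sizeA (suc j) = suc (suc j * suc (sizeA j))

-- Arguments i and j stand for excluding A_{i+1} and D_{j+1}. The sums take the place of maxima,
-- over the two induction hypotheses and over the two block sizes.
cliqueBound : ℕ → ℕ → ℕ
cliqueBound zero    j       = 0
cliqueBound (suc i) zero    = 0
cliqueBound (suc i) (suc j) =
  FinalBound.mainBound (cliqueBound i (suc j) + cliqueBound (suc i) j) (sizeA i + sizeD j) (suc j) (suc i)

module Sizes {V : Set} (arc : V → V → Bool) where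

  open Pattern arc

  length-D : ∀ {j l} → IsD j l → length l ≤ sizeD j
  length-D (point v) = ≤-refl
  length-D (node {A = A} v dA dB _ _ _) =
    s≤s (≤-trans (≤-reflexive (length-++ A)) (+-mono-≤ (length-D dA) (length-D dB)))

  length-A : ∀ j {l} → IsA j l → length l ≤ sizeA j
  length-A zero    (v , refl) = ≤-refl
  length-A (suc j) (u , is , alt , _ , refl) = s≤s (go alt)
    where
    go : ∀ {m is} → Alternating (IsA j) m is → length (flat is) ≤ m * suc (sizeA j)
    go [] = z≤n
    go (cons {m} {Z} {v} {is} cZ alt) = ≤-trans (≤-reflexive (length-++ Z))
      (≤-trans (+-mono-≤ (length-A j cZ) (s≤s (go alt))) (≤-reflexive (+-suc (sizeA j) _)))

  nonempty-A : ∀ j {l} → IsA j l → ∃ λ v → ∃ λ l′ → l ≡ v ∷ l′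
  nonempty-A zero    (v , refl)              = v , [] , refl
  nonempty-A (suc j) (u , is , _ , _ , refl) = u , _ , refl

module Induction {N : ℕ} (arc : Fin N → Fin N → Bool)
  (tri : ∀ u v → u ≡ v ⊎ arc u v ≡ true ⊎ arc v u ≡ true)
  (asym : ∀ {u v} → arc u v ≡ true → arc v u ≡ true → ⊥)
  (ω : (Fin N → Bool) → ℕ)
  (ω-Le : ∀ S → Cliques.Le arc (ω S) S) (ω-min : ∀ {k S} → Cliques.Le arc k S → ω S ≤ k) where

  open Concrete arc tri ω ω-Le ω-min
  open Pattern arc
  open Sizes arc

  -- If a set `S` heavier than `c` lacked one of the two smaller tournaments, the induction
  -- hypothesis for the universe `U ∩ S` would bound its weight by `c`.
  bounded : ∀ i j U → (∀ {l} → IsA i l → All (λ v → U v ≡ true) l → ⊥) →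
            (∀ {l} → IsD j l → All (λ v → U v ≡ true) l → ⊥) → cliqueBound i j < w U (λ _ → true) → ⊥
  bounded zero    j    U noA noD big = Weight.inhab (weight U) big λ v∈ → noA (_ , refl) (Sets.univ v∈ ∷ [])
  bounded (suc i) zero U noA noD big = Weight.inhab (weight U) big λ v∈ → noD (point _) (Sets.univ v∈ ∷ [])
  bounded (suc i) (suc j) U noA noD big =
    Final.impossible setting (absorbing U) N distinct-length (layered U) big
    where
    open Sets U
    c : ℕ
    c = cliqueBound i (suc j) + cliqueBound (suc i) j
    restrict : ∀ {S} → c < w U S → c < w (U ∩ S) (λ _ → true)
    restrict h = <-≤-trans h (ω-min (Cliques.Le-mono arc (λ e → ∩-intro e refl) (ω-Le _)))
    inside : ∀ {S l} → All (λ v → (U ∩ S) v ≡ true) l → All (λ v → U v ≡ true) l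
    inside = All.map ∩-left
    member : ∀ {S l} → All (λ v → (U ∩ S) v ≡ true) l → All (_∈ S) l
    member = All.map λ e → mem (∩-left e) (∩-right e)
    setting : Setting arc U (weight U) c (sizeA i + sizeD j) (suc j) (suc i)
    setting = record
      { tri = tri ; asym = asym ; CopyD = IsD j ; CopyA = IsA i
      ; lenD = λ d → ≤-trans (length-D d) (m≤n+m _ _)
      ; lenA = λ a → ≤-trans (length-A i a) (m≤m+n _ _)
      ; nonempty = nonempty-A i
      ; heavyD = λ {S} h none → bounded (suc i) j (U ∩ S) (λ a l∈ → noA a (inside l∈))
          (λ d l∈ → none _ d (member l∈)) (≤-<-trans (m≤n+m _ _) (restrict h))
      ; heavyA = λ {S} h none → bounded i (suc j) (U ∩ S) (λ a l∈ → none _ a (member l∈))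
          (λ d l∈ → noD d (inside l∈)) (≤-<-trans (m≤m+n _ _) (restrict h))
      ; triangle = λ {x} dA dB x∈ A∈ B∈ xA AB Bx →
          noD (node x dA dB xA AB Bx) (x∈ ∷ Allₚ.++⁺ A∈ B∈)
      ; noD = noD
      ; noA = λ alt ord l∈ → noA (_ , _ , alt , ord , refl) l∈ }

-- Choosing clique numbers, and orderings as permutations

-- Doubly negated because `P` is not decided; the final inequality is decidable, hence stable.
least : ∀ {P : ℕ → Set} n → P n → ¬ ¬ (∃ λ m → P m × (∀ k → P k → m ≤ k))
least {P} n pn kont = none (suc n) n ≤-refl pn
  where
  none : ∀ n m → m < n → ¬ P m
  none (suc n) m (s≤s m≤n) pm = kont (m , pm , λ k pk → ≮⇒≥ λ k<m → none n k (<-≤-trans k<m m≤n) pk)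

greatest : ∀ {P : ℕ → Set} b → (∀ m → P m → m ≤ b) → ∀ m → P m → ¬ ¬ (∃ λ m → P m × (∀ k → P k → k ≤ m))
greatest {P} b ≤b m pm kont = none b m (m≤m+n b m) pm
  where
  none : ∀ r m → b ≤ r + m → ¬ P m
  none zero    m h pm = kont (m , pm , λ k pk → ≤-trans (≤b k pk) h)
  none (suc r) m h pm = kont (m , pm , λ k pk → ≮⇒≥ λ m<k →
    none r k (≤-trans h (≤-trans (≤-reflexive (sym (+-suc r m))) (+-monoʳ-≤ r m<k))) pk)

-- Double negation moves past a quantifier over the finitely many Boolean vectors.
¬¬-choice : ∀ n {P : Vec Bool n → Set} → (∀ p → ¬ ¬ P p) → ¬ ¬ (∀ p → P p)
¬¬-choice zero    h kont = h [] λ x → kont λ { [] → x }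
¬¬-choice (suc n) h kont = ¬¬-choice n (λ p → h (true ∷ p)) λ f → ¬¬-choice n (λ p → h (false ∷ p)) λ g →
  kont λ { (true ∷ p) → f p ; (false ∷ p) → g p }

preds : ∀ {n} → List (Fin (suc n)) → List (Fin n)
preds []           = []
preds (zero ∷ xs)  = preds xs
preds (suc x ∷ xs) = x ∷ preds xs

length-preds : ∀ {n} (xs : List (Fin (suc n))) → length (preds xs) ≤ length xs
length-preds []           = z≤n
length-preds (zero ∷ xs)  = m≤n⇒m≤1+n (length-preds xs)
length-preds (suc x ∷ xs) = s≤s (length-preds xs)

length-preds< : ∀ {n} (xs : List (Fin (suc n))) → zero ∈ₗ xs → length (preds xs) < length xs
length-preds< (zero ∷ xs)  _          = s≤s (length-preds xs)
length-preds< (suc x ∷ xs) (there z∈) = s≤s (length-preds< xs z∈)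

∈-preds : ∀ {n} {x : Fin n} xs → suc x ∈ₗ xs → x ∈ₗ preds xs
∈-preds (zero ∷ xs)  (there x∈)  = ∈-preds xs x∈
∈-preds (suc x ∷ xs) (here refl) = here refl
∈-preds (suc x ∷ xs) (there x∈)  = there (∈-preds xs x∈)

card≤length : ∀ {n} (p : Subset n) xs → (∀ {x} → x ∈ₛ p → x ∈ₗ xs) → ∣ p ∣ ≤ length xs
card≤length []            xs cover = z≤n
card≤length (false ∷ p) xs cover =
  ≤-trans (card≤length p (preds xs) (λ x∈ → ∈-preds xs (cover (Vec.there x∈)))) (length-preds xs)
card≤length (true ∷ p)  xs cover =
  ≤-trans (s≤s (card≤length p (preds xs) (λ x∈ → ∈-preds xs (cover (Vec.there x∈)))))
          (length-preds< xs (cover Vec.here))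

distinct : ∀ {N} (L : List (Fin N)) → ∃ λ L′ → L′ ⊆ L × AllPairs _≢_ L′ × (∀ {v} → v ∈ₗ L → v ∈ₗ L′)
distinct []      = [] , [] , [] , λ ()
distinct (x ∷ L) with distinct L
... | L′ , L′⊆L , uniq , cover with ∈-dec _≟ᶠ_ x L′
...   | yes x∈ = L′ , x ∷ʳ L′⊆L , uniq , λ { (here refl) → x∈ ; (there v∈) → cover v∈ }
...   | no  x∉ = x ∷ L′ , refl ∷ L′⊆L ,
        All.tabulate (λ v∈ x≡v → x∉ (subst (_∈ₗ L′) (sym x≡v) v∈)) ∷ uniq ,
        λ { (here refl) → here refl ; (there v∈) → there (cover v∈) }

module _ (T : Tournament) where

  open Cliques (arc T)

  N : ℕ
  N = size T

  arc-tri : ∀ u v → u ≡ v ⊎ arc T u v ≡ true ⊎ arc T v u ≡ true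
  arc-tri u v with u ≟ᶠ v
  ... | yes eq = inj₁ eq
  ... | no neq with arc T v u in eq
  ...   | true  = inj₂ (inj₂ refl)
  ...   | false = inj₂ (inj₁ (trans (oneArc T u v neq) (cong not eq)))

  arc-asym : ∀ {u v} → arc T u v ≡ true → arc T v u ≡ true → ⊥
  arc-asym {u} {v} uv vu with u ≟ᶠ v
  ... | yes refl with trans (sym (irrefl T u)) uv
  ...   | ()
  arc-asym {u} {v} uv vu | no neq with trans (sym uv) (trans (oneArc T u v neq) (cong not vu))
  ...   | ()

  -- The indices in `L₀` freed of repetitions define an ordering. Its clique number, needed for
  -- comparison with `k`, is obtained by `greatest`, starting from the empty clique.
  order-bound : ∀ {R k} L → (∀ v → v ∈ₗ L) → Narrow R L → IsDiCliqueNumber T k → ¬ ¬ (k ≤ R)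
  order-bound {R} {k} L₀ cover₀ narrow₀ (_ , minimal) kont
    with distinct L₀
  ... | L , L⊆ , uniq , cover′ =
    greatest R (λ { m (S , clique , refl) → clique-small S clique }) 0 (∅ , (λ _ _ u∈ → ⊥-elim (∉⊥ u∈)) , ∣⊥∣≡0 N)
      λ { (m , isClique , largest) →
        kont (≤-trans (minimal ordering m (isClique , λ S c → largest ∣ S ∣ (S , c , refl)))
                      (small isClique)) }
    where
    cover : ∀ v → v ∈ₗ L
    cover v = cover′ (cover₀ v)
    position : Fin N → Fin N
    position v = inject≤ (index (cover v)) (distinct-length L uniq)
    position-injective : Injective _≡_ _≡_ position
    position-injective {u} {v} eq = trans (Anyₚ.lookup-index (cover u))
      (trans (cong (lookup L) (inject≤-injective _ _ _ _ eq)) (sym (Anyₚ.lookup-index (cover v))))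
    ordering : Ordering T
    ordering = position , position-injective
    position-lookup : ∀ i → toℕ (position (lookup L i)) ≡ toℕ i
    position-lookup i = trans (toℕ-inject≤ _ _)
      (cong toℕ (lookup-distinct uniq (sym (Anyₚ.lookup-index (cover (lookup L i))))))
    sorted : AllPairs (λ u v → toℕ (position u) < toℕ (position v)) L
    sorted = subst (AllPairs _) (tabulate-lookup L) (AllPairsₚ.tabulate⁺-< λ {i} {j} i<j →
      subst (_< toℕ (position (lookup L j))) (sym (position-lookup i))
        (subst (toℕ i <_) (sym (position-lookup j)) i<j))
    clique-small : ∀ S → IsClique T ordering S → ∣ S ∣ ≤ R
    clique-small S clique = ≤-trans
      (card≤length S (filter (_∈ₛ? S) L) (λ x∈ → ∈-filter⁺ (_∈ₛ? S) (cover _) x∈))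
      (narrow₀ (⊆-trans (filter-⊆ (_∈ₛ? S) L) L⊆)
        (backs (Allₚ.all-filter (_∈ₛ? S) L) (AllPairsₚ.filter⁺ (_∈ₛ? S) sorted)))
      where
      back : ∀ {u v} → u ∈ₛ S → v ∈ₛ S → toℕ (position u) < toℕ (position v) → arc T v u ≡ true
      back {u} {v} u∈ v∈ u<v with clique u v u∈ v∈ (λ { refl → <-irrefl refl u<v })
      ... | inj₁ (_ , vu)   = vu
      ... | inj₂ (v<u , _) = ⊥-elim (<-asym u<v v<u)
      backs : ∀ {ys} → All (_∈ₛ S) ys → AllPairs (λ u v → toℕ (position u) < toℕ (position v)) ys →
              AllPairs (λ u v → arc T v u ≡ true) ys
      backs []         []       = []
      backs (u∈ ∷ us∈) (h ∷ hs) = All.zipWith (λ (v∈ , u<v) → back u∈ v∈ u<v) (us∈ , h) ∷ backs us∈ hs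
    small : ∀ {m} → (Σ (Subset N) λ S → IsClique T ordering S × ∣ S ∣ ≡ m) → m ≤ R
    small (S , clique , refl) = clique-small S clique

  diclique-bound : ∀ i j {k} → ¬ HasA T (suc i) → ¬ HasD T (suc j) → IsDiCliqueNumber T k → ¬ ¬ (k ≤ cliqueBound i j)
  diclique-bound i j noA noD isω kont = ¬¬-choice N minimum λ choose →
    -- The minima are chosen per Boolean vector, where choice is finite, and carried over to
    -- predicates by tabulation.
    let ω : (Fin N → Bool) → ℕ
        ω S = proj₁ (choose (Vec.tabulate S))
        ω-Le : ∀ S → Le (ω S) S
        ω-Le S = Le-mono (λ {v} → trans (lookup∘tabulate S v)) (proj₁ (proj₂ (choose (Vec.tabulate S))))
        ω-min : ∀ {k S} → Le k S → ω S ≤ k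
        ω-min {k} {S} le = proj₂ (proj₂ (choose (Vec.tabulate S))) k
                             (Le-mono (λ {v} → trans (sym (lookup∘tabulate S v))) le)
        small = ≮⇒≥ (Induction.bounded (arc T) arc-tri arc-asym ω ω-Le ω-min i j (λ _ → true)
                  (λ a _ → noA (contains aarc-total (copy-A i a)))
                  (λ d _ → noD (contains darc-total (copy-D d))))
        L , cover , _ , narrow = ω-Le ((λ _ → true) ∩ (λ _ → true))
    in order-bound L (λ v → cover (∩-intro refl refl)) (λ ys⊆ back → ≤-trans (narrow ys⊆ back) small) isω kont
    where
    open Embeddings (arc T) (irrefl T) arc-asym
    contains : ∀ {H harc l} → Total harc → Copy H harc l → Contains T H harc
    contains total C = proj₁ C , copy-injective total C , proj₂ (proj₂ C)
    minimum : ∀ p → ¬ ¬ (∃ λ m → Le m (Vec.lookup p) × (∀ k → Le k (Vec.lookup p) → m ≤ k))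
    minimum p = least (length L) listed
      where
      P? = λ v → Vec.lookup p v ≟ᵇ true
      L : List (Fin N)
      L = filter P? (allFin N)
      listed : Le (length L) (Vec.lookup p)
      listed = L , (λ v∈ → ∈-filter⁺ P? (∈-allFin _) v∈) , Allₚ.all-filter P? (allFin N) ,
               λ ys⊆ _ → length-mono-≤ ys⊆

theorem3p1 : Σ (ℕ → ℕ) λ f →
    ∀ (T : Tournament) (a d k : ℕ) →
    IsOmegaA T a → IsOmegaD T d → IsDiCliqueNumber T k →
    k < f (a + d)
-- As s = a + d is at least both maxima, A_{s+1} and D_{s+1} are absent; `suc` makes the inequality
-- strict.
theorem3p1 = (λ s → suc (cliqueBound s s)) , λ T a d k (_ , maxA) (_ , maxD) isω →
  s≤s (decidable-stable (k ≤? cliqueBound (a + d) (a + d))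
    (diclique-bound T (a + d) (a + d)
      (λ h → 1+n≰n (≤-trans (maxA _ h) (m≤m+n a d)))
      (λ h → 1+n≰n (≤-trans (maxD _ h) (m≤n+m d a))) isω))
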